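{- Let $\varepsilon>0$, let $n$ be an integer and let $m\leq(\frac12-\varepsilon)\ln\ln n$. Then w.h.p.\ Breaker has a strategy to isolate a vertex in Maker's graph (i.e., to claim all $n-1$ edges of $K_n$ incident to some vertex) while playing the $(m:1)$ random-Maker game on $E(K_n)$.
   Context: The $(m:1)$ random-Maker game on the board $E(K_n)$: Maker and Breaker alternately claim previously unclaimed edges of $K_n$, Breaker moving first. In each round Breaker claims one unclaimed edge of his choice (according to a strategy), and Maker claims $m$ edges chosen uniformly at random among all unclaimed edges. "W.h.p." means with probability tending to $1$ as $n\to\infty$. -}

module Defs where

open import Data.Nat as ℕ using (ℕ; zero; suc)
open import Data.Fin as Fin using (Fin; toℕ)
open import Data.Fin.Properties using () renaming (_≟_ to _≟F_)
open import Data.Product using (_×_; _,_; proj₁; proj₂)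
open import Data.Product.Properties using (≡-dec)
open import Data.List using (List; []; _∷_; filter; length; allFin; concatMap; map; foldr)
open import Data.List.Relation.Unary.All using (all?)
open import Data.List.Relation.Unary.Any using (any?)
open import Data.Bool using (Bool; true; false; if_then_else_)
open import Data.Rational as ℚ using (ℚ; 0ℚ; 1ℚ; _+_; _*_; _≤_)
open import Data.Rational.Properties using () renaming (_≟_ to _≟Q_)
open import Data.Integer using (+_)
open import Relation.Nullary using (Dec; yes; no; ¬_; ¬?; _⊎-dec_)
open import Relation.Nullary.Decidable using (⌊_⌋)
open import Relation.Binary.Definitions using (DecidableEquality)
open import Relation.Binary.PropositionalEquality using (_≡_)

-- An edge {i,j} of K_n is represented by the ordered pair (i , j) with i < j.
Edge : ℕ → Set
Edge n = Fin n × Fin n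

_≟E_ : ∀ {n} → DecidableEquality (Edge n)
_≟E_ = ≡-dec _≟F_ _≟F_

module _ {n : ℕ} where
  open import Data.List.Membership.DecPropositional (_≟E_ {n}) using (_∈?_) public

allEdges : (n : ℕ) → List (Edge n)
allEdges n = filter (λ e → toℕ (proj₁ e) ℕ.<? toℕ (proj₂ e))
                    (concatMap (λ i → map (λ j → (i , j)) (allFin n)) (allFin n))

incident : (n : ℕ) → Fin n → List (Edge n)
incident n v = filter (λ e → (proj₁ e ≟F v) ⊎-dec (proj₂ e ≟F v)) (allEdges n)

unclaimed : (n : ℕ) → List (Edge n) → List (Edge n) → List (Edge n)
unclaimed n B M = filter (λ e → ¬? (e ∈? B)) (filter (λ e → ¬? (e ∈? M)) (allEdges n))

BreakerIsolates : (n : ℕ) → List (Edge n) → Bool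
BreakerIsolates n B = ⌊ any? (λ v → all? (λ e → e ∈? B) (incident n v)) (allFin n) ⌋

-- A (deterministic) Breaker strategy: given Breaker's claimed edges and
-- Maker's claimed edges so far, the edge Breaker claims next.
Strategy : ℕ → Set
Strategy n = List (Edge n) → List (Edge n) → Edge n

indicator : Bool → ℚ
indicator true  = 1ℚ
indicator false = 0ℚ

average : ∀ {A : Set} → (A → ℚ) → List A → ℚ
average f []         = 0ℚ
average f (x ∷ xs) = ((+ 1) ℚ./ suc (length xs)) * foldr (λ y s → f y + s) 0ℚ (x ∷ xs)

module Game (n m : ℕ) (σ : Strategy n) where
  mutual
    -- Probability that Breaker wins when it is Breaker's turn,
    -- with fuel f bounding the remaining number of Breaker turns.
    breakerTurn : ℕ → List (Edge n) → List (Edge n) → ℚ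
    breakerTurn zero    B M = indicator (BreakerIsolates n B)
    breakerTurn (suc f) B M with unclaimed n B M
    ... | []    = indicator (BreakerIsolates n B)
    ... | _ ∷ _ with σ B M ∈? unclaimed n B M
    ...   | no  _ = 0ℚ                                   -- illegal move: Breaker forfeits
    ...   | yes _ = makerTurn m f (σ B M ∷ B) M

    -- Maker still has k random edges to claim in the current round: each is
    -- chosen uniformly at random among the unclaimed edges (sequentially
    -- choosing k distinct uniform edges = a uniform random k-set of edges).
    makerTurn : ℕ → ℕ → List (Edge n) → List (Edge n) → ℚ
    makerTurn zero    f B M = breakerTurn f B M
    makerTurn (suc k) f B M with unclaimed n B M
    ... | []    = breakerTurn f B M
    ... | e ∷ U = average (λ e' → makerTurn k f B (e' ∷ M)) (e ∷ U)

-- Probability that Breaker, playing σ and moving first, isolates a vertex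
-- in Maker's graph in the (m:1) random-Maker game on E(K_n).
-- Fuel = number of edges + 1 suffices, as each Breaker turn claims an edge.
winProb : (n m : ℕ) → Strategy n → ℚ
winProb n m σ = Game.breakerTurn n m σ (suc (length (allEdges n))) [] []

-- Real-number threshold  m ≤ c · ln ln n  (for rational c > 0), expressed
-- through rational Taylor partial sums of exp:
--   m ≤ c ln ln n  ⟺  exp (exp (m / c)) ≤ n
--                 ⟺  ∀ j k, S_j (S_k (m / c)) ≤ n,
-- where S_k x = Σ_{i<k} x^i / i! (increasing in k, with limit exp x, for x ≥ 0,
-- and increasing and continuous in x ≥ 0).

expTerms : ℕ → ℚ → ℚ × ℚ
expTerms zero    x = 0ℚ , 1ℚ
expTerms (suc k) x with expTerms k x
... | s , t = s + t , t * x * ((+ 1) ℚ./ suc k)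

expPartial : ℕ → ℚ → ℚ
expPartial k x = proj₁ (expTerms k x)

-- 1/c for c ≠ 0 (value at 0 irrelevant; only used for c > 0).
recip : ℚ → ℚ
recip c with c ≟Q 0ℚ
... | yes _ = 0ℚ
... | no c≢0 = ℚ.1/_ c {{ℚ.≢-nonZero c≢0}}

fromℕ : ℕ → ℚ
fromℕ k = (+ k) ℚ./ 1

-- m ≤ c · ln ln n   (meaningful for c > 0)
LeCLnLn : ℚ → ℕ → ℕ → Set
LeCLnLn c m n = ∀ j k → expPartial j (expPartial k (fromℕ m * recip c)) ≤ fromℕ n

{-# OPTIONS --safe #-}
-- Breaker always plays at the first vertex (in the order of Fin n) that Maker has not touched; once Maker touches it,
-- Breaker turns to the next untouched vertex. A vertex with r free edges is hit by one Maker edge with probability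
-- about 2r/n², so a try of at most n rounds succeeds with probability about exp (-m) (here: at least 6^-m), and
-- J = D 6^m further tries fail with probability at most 1/D. These tries last at most (J + 1) n rounds, and each Maker
-- edge multiplies the expectation of 1/U, where U counts the untouched vertices, by at most about 1 + 16/n; so there
-- remain untouched vertices with high probability as long as exp (O (J m)) is small compared with n. Since
-- n ≥ exp (exp (2m)) and exp 2 > 7 > 6, this is the case. Both failure probabilities are carried by one potential, which
-- bounds the losing probability by backward induction on the game.
module Submission where

open import Defs
open import Data.Nat using (ℕ; _≥_)
open import Data.Product using (Σ; ∃; ∃-syntax; _×_)
open import Data.Rational using (ℚ; 0ℚ; ½; 1ℚ; _<_; _≤_; _-_)

open import Algebra.Bundles using (CommutativeRing)
open import Data.Bool using (true; false)
open import Data.Fin using (Fin; toℕ)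
open import Data.Fin.Properties using (toℕ-injective) renaming (_≟_ to _≟F_)
open import Data.Integer using (+_)
import Data.Integer as ℤ
import Data.Integer.Properties as ℤ
open import Data.List using (List; []; _∷_; _++_; length; filter; map; concatMap; allFin; cartesianProduct; foldr)
open import Data.List.Properties using (length-++; length-map; length-tabulate)
open import Data.List.Membership.Propositional using (_∈_; _∉_; lose)
open import Data.List.Membership.Propositional.Properties
open import Data.List.Relation.Binary.Subset.Propositional using (_⊆_)
open import Data.List.Relation.Unary.All as All using (All)
open import Data.List.Relation.Unary.AllPairs using (_∷_)
open import Data.List.Relation.Unary.Any as Any using (Any; here; there)
open import Data.List.Relation.Unary.Unique.Propositional using (Unique)
open import Data.List.Relation.Unary.Unique.Propositional.Properties using (allFin⁺; filter⁺; cartesianProduct⁺; Unique[x∷xs]⇒x∉xs)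
open import Data.Nat using (zero; suc; z≤n; s≤s)
import Data.Nat as ℕ
open import Data.Nat.DivMod using (m/n*n≤m; m≡m%n+[m/n]*n; m%n<n)
import Data.Nat.Properties as ℕ
open import Data.Nat.Solver using () renaming (module +-*-Solver to N)
open import Data.Product using (_,_; proj₁; proj₂; swap)
open import Data.Rational using (mkℚ; _+_; _*_; -_; toℚᵘ)
import Data.Rational as ℚ
import Data.Rational.Properties as ℚ
open import Data.Rational.Solver using (module +-*-Solver)
open +-*-Solver using (solve; _:=_; con) renaming (_:+_ to _⊕_; _:*_ to _⊛_; _:-_ to _⊖_)
import Data.Rational.Unnormalised as ℚᵘ
import Data.Rational.Unnormalised.Properties as ℚᵘ
open import Data.Sum using (_⊎_; inj₁; inj₂)
open import Data.Unit using (tt)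
open import Relation.Binary using (tri<; tri≈; tri>)
open import Relation.Binary.PropositionalEquality hiding (J)
open import Relation.Nullary using (Dec; yes; no; ¬_; ¬?; _⊎-dec_; contradiction)
open import Relation.Nullary.Decidable using (isYes≗does; dec-true)

open import Algebra.Properties.CommutativeSemiring.Exp (CommutativeRing.commutativeSemiring ℚ.+-*-commutativeRing)
  using (_^_; ^-homo-*; ^-assocʳ; ^-distrib-*)

-- Lists and the board

-- Maker's edges are drawn from boards of varying size `L`, and rational arithmetic has no
-- exponential. Both difficulties are met by one base `b = (X + 1) / X` with inverse `β`, playing
-- the part of exp (1/X). If at least `X + n` edges are unclaimed, missing `r` given edges has
-- probability `1 - r / L ≥ β ^ r`, so the risks of a whole try add up in one exponent, about
-- `m n² / 2`, and the only numerical fact needed about `b` is `b ^ (X / 3) ≤ 3/2`. The reciprocal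
-- of the number `u` of untouched vertices is tracked because its expected relative growth does not
-- depend on `u`: one edge raises `1 / u` by at most `6 / u²`, at most `u n` edges raise it at all,
-- and the product over `L` is `6 n / L` times `1 / u`. The failure of all tries is tracked by
-- `w ^ j * (1 - g)` with `w = 1 - q`, where `g` and `q` bound the success probabilities of the
-- current try and of any new try from below. A hit turns this into at most
-- `w ^ (j - 1) * (1 - q) = w ^ j`, so it costs at most `w ^ j * g`.

module _ {A : Set} where

  -- Pigeonhole; every count on the board below is reduced to it by an inclusion of lists. The
  -- induction deletes the head from `ys`.
  Unique-⊆⇒length≤ : {xs ys : List A} → Unique xs → xs ⊆ ys → length xs ℕ.≤ length ys
  Unique-⊆⇒length≤ {[]} _ _ = z≤n
  Unique-⊆⇒length≤ {x ∷ xs} {ys} u@(_ ∷ uxs) xs⊆ys with ∈-∃++ (xs⊆ys (here refl))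
  ... | ps , qs , refl = begin
    suc (length xs)                 ≤⟨ s≤s (Unique-⊆⇒length≤ uxs remaining) ⟩
    suc (length (ps ++ qs))         ≡⟨ cong suc (length-++ ps) ⟩
    suc (length ps ℕ.+ length qs)   ≡⟨ ℕ.+-suc (length ps) (length qs) ⟨
    length ps ℕ.+ length (x ∷ qs)   ≡⟨ length-++ ps ⟨
    length (ps ++ x ∷ qs)           ∎
    where
    open ℕ.≤-Reasoning
    remaining : xs ⊆ ps ++ qs
    remaining {y} y∈xs with ∈-++⁻ ps (xs⊆ys (there y∈xs))
    ... | inj₁ y∈ps           = ∈-++⁺ˡ y∈ps
    ... | inj₂ (here refl)    = contradiction y∈xs (Unique[x∷xs]⇒x∉xs u)
    ... | inj₂ (there y∈qs)   = ∈-++⁺ʳ ps y∈qs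

  headOr : A → List A → A
  headOr d []      = d
  headOr d (x ∷ _) = x

  headOr-∈ : ∀ d xs → 0 ℕ.< length xs → headOr d xs ∈ xs
  headOr-∈ d (x ∷ xs) _ = here refl

  headOr-++ : ∀ d {xs} ys → 0 ℕ.< length xs → headOr d (xs ++ ys) ∈ xs
  headOr-++ d {x ∷ xs} ys _ = here refl

  -- Everything before `v` fails `P`, hence the stronger `Q`, so `v` stays first. This is why a
  -- target recomputed from Maker's edges alone does not change while Maker misses it.
  head-filter : {P Q : A → Set} (P? : ∀ x → Dec (P x)) (Q? : ∀ x → Dec (Q x)) →
    (∀ {x} → Q x → P x) → ∀ {v vs} xs → filter P? xs ≡ v ∷ vs → Q v →
    ∃ λ vs′ → filter Q? xs ≡ v ∷ vs′
  head-filter P? Q? Q⇒P (x ∷ xs) eq Qv with P? x | Q? x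
  head-filter P? Q? Q⇒P (x ∷ xs) refl Qv | yes _ | yes _  = _ , refl
  head-filter P? Q? Q⇒P (x ∷ xs) refl Qv | yes _ | no ¬Qx = contradiction Qv ¬Qx
  head-filter P? Q? Q⇒P (x ∷ xs) eq Qv | no ¬Px | yes Qx  = contradiction (Q⇒P Qx) ¬Px
  head-filter P? Q? Q⇒P (x ∷ xs) eq Qv | no _ | no _      = head-filter P? Q? Q⇒P xs eq Qv

length-concatMap-const : {A B : Set} (f : A → List B) (k : ℕ) → (∀ x → length (f x) ≡ k) →
  ∀ xs → length (concatMap f xs) ≡ length xs ℕ.* k
length-concatMap-const f k eq [] = refl
length-concatMap-const f k eq (x ∷ xs) = trans (length-++ (f x)) (cong₂ ℕ._+_ (eq x) (length-concatMap-const f k eq xs))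

length-allFin : ∀ n → length (allFin n) ≡ n
length-allFin n = length-tabulate {n = n} (λ i → i)

-- Counting edges, free edges and untouched vertices

Touches : ∀ {n} → Fin n → Edge n → Set
Touches v e = proj₁ e ≡ v ⊎ proj₂ e ≡ v

touches? : ∀ {n} (v : Fin n) (e : Edge n) → Dec (Touches v e)
touches? v e = (proj₁ e ≟F v) ⊎-dec (proj₂ e ≟F v)

module Board (n : ℕ) where

  pairs : List (Edge n)
  pairs = concatMap (λ i → map (λ j → (i , j)) (allFin n)) (allFin n)

  pairs≡cartesianProduct : pairs ≡ cartesianProduct (allFin n) (allFin n)
  pairs≡cartesianProduct = go (allFin n)
    where
    go : ∀ is → concatMap (λ i → map (λ j → (i , j)) (allFin n)) is ≡ cartesianProduct is (allFin n)
    go [] = refl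
    go (i ∷ is) = cong (map (λ j → (i , j)) (allFin n) ++_) (go is)

  pairs-unique : Unique pairs
  pairs-unique = subst Unique (sym pairs≡cartesianProduct) (cartesianProduct⁺ (allFin⁺ n) (allFin⁺ n))

  ∈-pairs : ∀ e → e ∈ pairs
  ∈-pairs (i , j) = subst ((i , j) ∈_) (sym pairs≡cartesianProduct) (∈-cartesianProduct⁺ (∈-allFin i) (∈-allFin j))

  Ordered : Edge n → Set
  Ordered e = toℕ (proj₁ e) ℕ.< toℕ (proj₂ e)

  ordered? : ∀ e → Dec (Ordered e)
  ordered? e = toℕ (proj₁ e) ℕ.<? toℕ (proj₂ e)

  allEdges-unique : Unique (allEdges n)
  allEdges-unique = filter⁺ ordered? pairs-unique

  ∈-allEdges⁺ : ∀ {e} → Ordered e → e ∈ allEdges n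
  ∈-allEdges⁺ {e} = ∈-filter⁺ ordered? (∈-pairs e)

  ∈-allEdges⁻ : ∀ {e} → e ∈ allEdges n → Ordered e
  ∈-allEdges⁻ p = proj₂ (∈-filter⁻ ordered? {xs = pairs} p)

  -- The edges, their reversals and the diagonal cover all ordered pairs; written without
  -- subtraction.
  n²≤2∣E∣+n : n ℕ.* n ℕ.≤ length (allEdges n) ℕ.+ (length (allEdges n) ℕ.+ n)
  n²≤2∣E∣+n = begin
    n ℕ.* n              ≡⟨ cong (ℕ._* n) (length-allFin n) ⟨
    length (allFin n) ℕ.* n
      ≡⟨ length-concatMap-const _ n (λ i → trans (length-map _ (allFin n)) (length-allFin n)) (allFin n) ⟨
    length pairs         ≤⟨ Unique-⊆⇒length≤ pairs-unique cover ⟩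
    length (Es ++ map swap Es ++ map (λ i → (i , i)) (allFin n)) ≡⟨ length-++ Es ⟩
    length Es ℕ.+ length (map swap Es ++ map (λ i → (i , i)) (allFin n))
      ≡⟨ cong (length Es ℕ.+_) (length-++ (map swap Es)) ⟩
    length Es ℕ.+ (length (map swap Es) ℕ.+ length (map (λ i → (i , i)) (allFin n)))
      ≡⟨ cong (length Es ℕ.+_) (cong₂ ℕ._+_ (length-map swap Es) (trans (length-map _ (allFin n)) (length-allFin n))) ⟩
    length Es ℕ.+ (length Es ℕ.+ n) ∎
    where
    open ℕ.≤-Reasoning
    Es = allEdges n
    cover : pairs ⊆ Es ++ map swap Es ++ map (λ i → (i , i)) (allFin n)
    cover {i , j} _ with ℕ.<-cmp (toℕ i) (toℕ j)
    ... | tri< i<j _ _ = ∈-++⁺ˡ (∈-allEdges⁺ i<j)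
    ... | tri> _ _ j<i = ∈-++⁺ʳ Es (∈-++⁺ˡ (∈-map⁺ swap (∈-allEdges⁺ {j , i} j<i)))
    ... | tri≈ _ i≡j _ with toℕ-injective i≡j
    ... | refl = ∈-++⁺ʳ Es (∈-++⁺ʳ (map swap Es) (∈-map⁺ (λ i → (i , i)) (∈-allFin i)))

  joinWith : Fin n → Fin n → Edge n
  joinWith v w with toℕ v ℕ.<? toℕ w
  ... | yes _ = v , w
  ... | no  _ = w , v

  -- One entry, the loop at `v`, is not an edge; keeping it gives the round bound `n` for the
  -- degree.
  star : Fin n → List (Edge n)
  star v = map (joinWith v) (allFin n)

  length-star : ∀ v → length (star v) ≡ n
  length-star v = trans (length-map _ (allFin n)) (length-allFin n)

  ∈-star : ∀ {e v} → e ∈ allEdges n → Touches v e → e ∈ star v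
  ∈-star {v , w} e∈E (inj₁ refl) = subst (_∈ star v) eq (∈-map⁺ (joinWith v) (∈-allFin w))
    where
    eq : joinWith v w ≡ (v , w)
    eq with toℕ v ℕ.<? toℕ w
    ... | yes _ = refl
    ... | no v≮w = contradiction (∈-allEdges⁻ e∈E) v≮w
  ∈-star {w , v} e∈E (inj₂ refl) = subst (_∈ star v) eq (∈-map⁺ (joinWith v) (∈-allFin w))
    where
    eq : joinWith v w ≡ (w , v)
    eq with toℕ v ℕ.<? toℕ w
    ... | yes v<w = contradiction (∈-allEdges⁻ e∈E) (ℕ.<-asym v<w)
    ... | no _ = refl

  ∈-unclaimed⁺ : ∀ {B M e} → e ∈ allEdges n → e ∉ B → e ∉ M → e ∈ unclaimed n B M
  ∈-unclaimed⁺ {B} {M} p q r = ∈-filter⁺ (λ e → ¬? (e ∈? B)) (∈-filter⁺ (λ e → ¬? (e ∈? M)) p r) q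

  ∈-unclaimed⁻ : ∀ {B M e} → e ∈ unclaimed n B M → e ∈ allEdges n × e ∉ B × e ∉ M
  ∈-unclaimed⁻ {B} {M} p with ∈-filter⁻ (λ e → ¬? (e ∈? B)) {xs = filter (λ e → ¬? (e ∈? M)) (allEdges n)} p
  ... | q , e∉B with ∈-filter⁻ (λ e → ¬? (e ∈? M)) {xs = allEdges n} q
  ... | e∈E , e∉M = e∈E , e∉B , e∉M

  unclaimed-unique : ∀ B M → Unique (unclaimed n B M)
  unclaimed-unique B M = filter⁺ (λ e → ¬? (e ∈? B)) (filter⁺ (λ e → ¬? (e ∈? M)) allEdges-unique)

  unclaimed-Breaker : ∀ B M e → length (unclaimed n B M) ℕ.≤ suc (length (unclaimed n (e ∷ B) M))
  unclaimed-Breaker B M e = Unique-⊆⇒length≤ {ys = e ∷ unclaimed n (e ∷ B) M} (unclaimed-unique B M) sub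
    where
    sub : unclaimed n B M ⊆ e ∷ unclaimed n (e ∷ B) M
    sub {x} x∈U with x ≟E e | ∈-unclaimed⁻ {B} {M} x∈U
    ... | yes refl | _ = here refl
    ... | no x≢e | x∈E , x∉B , x∉M = there (∈-unclaimed⁺ x∈E (λ { (here x≡e) → x≢e x≡e ; (there x∈B) → x∉B x∈B }) x∉M)

  unclaimed-Maker : ∀ B M e → length (unclaimed n B M) ℕ.≤ suc (length (unclaimed n B (e ∷ M)))
  unclaimed-Maker B M e = Unique-⊆⇒length≤ {ys = e ∷ unclaimed n B (e ∷ M)} (unclaimed-unique B M) sub
    where
    sub : unclaimed n B M ⊆ e ∷ unclaimed n B (e ∷ M)
    sub {x} x∈U with x ≟E e | ∈-unclaimed⁻ {B} {M} x∈U
    ... | yes refl | _ = here refl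
    ... | no x≢e | x∈E , x∉B , x∉M = there (∈-unclaimed⁺ x∈E x∉B (λ { (here x≡e) → x≢e x≡e ; (there x∈M) → x∉M x∈M }))

  freeAt : Fin n → List (Edge n) → List (Edge n) → List (Edge n)
  freeAt v B M = filter (touches? v) (unclaimed n B M)

  freeAt-unique : ∀ v B M → Unique (freeAt v B M)
  freeAt-unique v B M = filter⁺ (touches? v) (unclaimed-unique B M)

  ∈-freeAt⁻ : ∀ {v B M e} → e ∈ freeAt v B M → e ∈ unclaimed n B M × Touches v e
  ∈-freeAt⁻ {v} {B} {M} = ∈-filter⁻ (touches? v) {xs = unclaimed n B M}

  freeAt≤n : ∀ v B M → length (freeAt v B M) ℕ.≤ n
  freeAt≤n v B M = ℕ.≤-trans (Unique-⊆⇒length≤ (freeAt-unique v B M) sub) (ℕ.≤-reflexive (length-star v))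
    where
    sub : freeAt v B M ⊆ star v
    sub p with ∈-freeAt⁻ {v} {B} {M} p
    ... | q , t = ∈-star (proj₁ (∈-unclaimed⁻ {B} {M} q)) t

  freeAt-Breaker : ∀ {v B M e} → e ∈ freeAt v B M → suc (length (freeAt v (e ∷ B) M)) ℕ.≤ length (freeAt v B M)
  freeAt-Breaker {v} {B} {M} {e} e∈F = Unique-⊆⇒length≤ {xs = e ∷ freeAt v (e ∷ B) M} (All.tabulate fresh ∷ freeAt-unique v (e ∷ B) M) sub
    where
    fresh : ∀ {x} → x ∈ freeAt v (e ∷ B) M → e ≢ x
    fresh p refl = proj₁ (proj₂ (∈-unclaimed⁻ {e ∷ B} {M} (proj₁ (∈-freeAt⁻ {v} {e ∷ B} {M} p)))) (here refl)
    sub : e ∷ freeAt v (e ∷ B) M ⊆ freeAt v B M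
    sub (here refl) = e∈F
    sub (there p) with ∈-freeAt⁻ {v} {e ∷ B} {M} p
    ... | q , t with ∈-unclaimed⁻ {e ∷ B} {M} q
    ... | x∈E , x∉B , x∉M = ∈-filter⁺ (touches? v) (∈-unclaimed⁺ x∈E (λ z → x∉B (there z)) x∉M) t

  freeAt-Maker : ∀ v B M e → length (freeAt v B (e ∷ M)) ℕ.≤ length (freeAt v B M)
  freeAt-Maker v B M e = Unique-⊆⇒length≤ (freeAt-unique v B (e ∷ M)) sub
    where
    sub : freeAt v B (e ∷ M) ⊆ freeAt v B M
    sub p with ∈-freeAt⁻ {v} {B} {e ∷ M} p
    ... | q , t with ∈-unclaimed⁻ {B} {e ∷ M} q
    ... | x∈E , x∉B , x∉M = ∈-filter⁺ (touches? v) (∈-unclaimed⁺ x∈E x∉B (λ z → x∉M (there z))) t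

  Untouched : List (Edge n) → Fin n → Set
  Untouched M v = ¬ Any (Touches v) M

  untouched? : ∀ M v → Dec (Untouched M v)
  untouched? M v = ¬? (Any.any? (touches? v) M)

  untouched : List (Edge n) → List (Fin n)
  untouched M = filter (untouched? M) (allFin n)

  ∈-untouched⁻ : ∀ {M v} → v ∈ untouched M → Untouched M v
  ∈-untouched⁻ {M} p = proj₂ (∈-filter⁻ (untouched? M) {xs = allFin n} p)

  untouched-∷ : ∀ {M e v} → Untouched M v → ¬ Touches v e → Untouched (e ∷ M) v
  untouched-∷ u ¬t (here t)  = ¬t t
  untouched-∷ u ¬t (there t) = u t

  length-untouched-[] : length (untouched []) ≡ n
  length-untouched-[] = trans (go (allFin n)) (length-allFin n)
    where
    go : ∀ vs → length (filter (untouched? []) vs) ≡ length vs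
    go [] = refl
    go (_ ∷ vs) = cong suc (go vs)

  untouched-step : ∀ M e → length (untouched M) ℕ.≤ 2 ℕ.+ length (untouched (e ∷ M))
  untouched-step M e = Unique-⊆⇒length≤ {ys = proj₁ e ∷ proj₂ e ∷ untouched (e ∷ M)} (filter⁺ (untouched? M) (allFin⁺ n)) sub
    where
    sub : untouched M ⊆ proj₁ e ∷ proj₂ e ∷ untouched (e ∷ M)
    sub {v} p with touches? v e
    ... | yes (inj₁ refl) = here refl
    ... | yes (inj₂ refl) = there (here refl)
    ... | no ¬t = there (there (∈-filter⁺ (untouched? (e ∷ M)) (∈-allFin v) (untouched-∷ (∈-untouched⁻ {M} p) ¬t)))

  Damaging : List (Edge n) → Edge n → Set
  Damaging M e = Any (λ v → Touches v e) (untouched M)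

  damaging? : ∀ M e → Dec (Damaging M e)
  damaging? M e = Any.any? (λ v → touches? v e) (untouched M)

  untouched-harmless : ∀ M e → ¬ Damaging M e → length (untouched M) ℕ.≤ length (untouched (e ∷ M))
  untouched-harmless M e ¬d = Unique-⊆⇒length≤ (filter⁺ (untouched? M) (allFin⁺ n)) sub
    where
    sub : untouched M ⊆ untouched (e ∷ M)
    sub {v} p = ∈-filter⁺ (untouched? (e ∷ M)) (∈-allFin v) (untouched-∷ (∈-untouched⁻ {M} p) (λ t → ¬d (lose p t)))

  -- Union bound: a damaging edge lies in the star of some untouched vertex.
  damaging-count : ∀ B M → length (filter (damaging? M) (unclaimed n B M)) ℕ.≤ length (untouched M) ℕ.* n
  damaging-count B M = ℕ.≤-trans (Unique-⊆⇒length≤ (filter⁺ (damaging? M) (unclaimed-unique B M)) sub)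
      (ℕ.≤-reflexive (length-concatMap-const star n length-star (untouched M)))
    where
    sub : filter (damaging? M) (unclaimed n B M) ⊆ concatMap star (untouched M)
    sub p with ∈-filter⁻ (damaging? M) {xs = unclaimed n B M} p
    ... | q , d = ∈-concatMap⁺ star {xs = untouched M} (Any.map (∈-star (proj₁ (∈-unclaimed⁻ {B} {M} q))) d)

  target-stable : ∀ {M e v vs} → untouched M ≡ v ∷ vs → ¬ Touches v e → ∃ λ vs′ → untouched (e ∷ M) ≡ v ∷ vs′
  target-stable {M} {e} {v} eq ¬t = head-filter (untouched? M) (untouched? (e ∷ M)) (λ u a → u (there a)) (allFin n) eq
      (untouched-∷ (∈-untouched⁻ {M} (subst (v ∈_) (sym eq) (here refl))) ¬t)

-- Rational arithmetic

0≤* : ∀ {a b} → 0ℚ ≤ a → 0ℚ ≤ b → 0ℚ ≤ a * b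
0≤* {a} {b} 0≤a 0≤b = subst (_≤ a * b) (ℚ.*-zeroʳ a) (ℚ.*-monoˡ-≤-nonNeg a {{ℚ.nonNegative 0≤a}} 0≤b)

0≤+ : ∀ {a b} → 0ℚ ≤ a → 0ℚ ≤ b → 0ℚ ≤ a + b
0≤+ = ℚ.+-mono-≤

*-mono-≤ : ∀ {a b c d} → 0ℚ ≤ b → 0ℚ ≤ c → a ≤ b → c ≤ d → a * c ≤ b * d
*-mono-≤ {a} {b} {c} {d} 0≤b 0≤c a≤b c≤d = ℚ.≤-trans
  (ℚ.*-monoʳ-≤-nonNeg c {{ℚ.nonNegative 0≤c}} a≤b)
  (ℚ.*-monoˡ-≤-nonNeg b {{ℚ.nonNegative 0≤b}} c≤d)

*-monoˡ-≤ : ∀ {a b c} → 0ℚ ≤ c → a ≤ b → c * a ≤ c * b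
*-monoˡ-≤ {c = c} 0≤c = ℚ.*-monoˡ-≤-nonNeg c {{ℚ.nonNegative 0≤c}}

0≤- : ∀ {a b} → a ≤ b → 0ℚ ≤ b - a
0≤- {a} {b} a≤b = subst (_≤ b - a) (ℚ.+-inverseʳ a) (ℚ.+-monoˡ-≤ (- a) a≤b)

-- Inequalities are certified by exhibiting the difference of the two sides as a non-negative quantity.
≤-by : ∀ {a b d} → 0ℚ ≤ d → a + d ≡ b → a ≤ b
≤-by {a} {b} {d} 0≤d refl = subst (_≤ a + d) (ℚ.+-identityʳ a) (ℚ.+-monoʳ-≤ a 0≤d)

0≤1 : 0ℚ ≤ 1ℚ
0≤1 = ℚ.nonNegative⁻¹ 1ℚ

fromℕ-+ : ∀ a b → fromℕ (a ℕ.+ b) ≡ fromℕ a + fromℕ b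
fromℕ-+ a b = ℚ.toℚᵘ-injective (begin
  toℚᵘ (fromℕ (a ℕ.+ b))               ≈⟨ ℚ.toℚᵘ-fromℚᵘ (ℚᵘ.mkℚᵘ (+ (a ℕ.+ b)) 0) ⟩
  ℚᵘ.mkℚᵘ (+ (a ℕ.+ b)) 0
    ≈⟨ ℚᵘ.*≡* (cong (ℤ._* + 1) (cong₂ ℤ._+_ (sym (ℤ.*-identityʳ (+ a))) (sym (ℤ.*-identityʳ (+ b))))) ⟩
  ℚᵘ.mkℚᵘ (+ a) 0 ℚᵘ.+ ℚᵘ.mkℚᵘ (+ b) 0
    ≈⟨ ℚᵘ.+-cong (ℚ.toℚᵘ-fromℚᵘ (ℚᵘ.mkℚᵘ (+ a) 0)) (ℚ.toℚᵘ-fromℚᵘ (ℚᵘ.mkℚᵘ (+ b) 0)) ⟨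
  toℚᵘ (fromℕ a) ℚᵘ.+ toℚᵘ (fromℕ b)   ≈⟨ ℚ.toℚᵘ-homo-+ (fromℕ a) (fromℕ b) ⟨
  toℚᵘ (fromℕ a + fromℕ b)             ∎)
  where open ℚᵘ.≃-Reasoning

fromℕ-suc : ∀ a → fromℕ (suc a) ≡ 1ℚ + fromℕ a
fromℕ-suc a = fromℕ-+ 1 a

fromℕ-* : ∀ a b → fromℕ (a ℕ.* b) ≡ fromℕ a * fromℕ b
fromℕ-* zero b = sym (ℚ.*-zeroˡ (fromℕ b))
fromℕ-* (suc a) b = begin
  fromℕ (b ℕ.+ a ℕ.* b)           ≡⟨ fromℕ-+ b (a ℕ.* b) ⟩
  fromℕ b + fromℕ (a ℕ.* b)       ≡⟨ cong (fromℕ b ℚ.+_) (fromℕ-* a b) ⟩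
  fromℕ b + fromℕ a * fromℕ b     ≡⟨ solve 2 (λ x y → y ⊕ x ⊛ y := (con 1ℚ ⊕ x) ⊛ y) refl (fromℕ a) (fromℕ b) ⟩
  (1ℚ + fromℕ a) * fromℕ b        ≡⟨ cong (_* fromℕ b) (fromℕ-suc a) ⟨
  fromℕ (suc a) * fromℕ b         ∎
  where open ≡-Reasoning

fromℕ-mono-≤ : ∀ {a b} → a ℕ.≤ b → fromℕ a ≤ fromℕ b
fromℕ-mono-≤ {a} {b} a≤b = ℚ.toℚᵘ-cancel-≤ (begin
  toℚᵘ (fromℕ a)    ≃⟨ ℚ.toℚᵘ-fromℚᵘ (ℚᵘ.mkℚᵘ (+ a) 0) ⟩
  ℚᵘ.mkℚᵘ (+ a) 0   ≤⟨ ℚᵘ.*≤* (ℤ.*-monoʳ-≤-nonNeg (+ 1) (ℤ.+≤+ a≤b)) ⟩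
  ℚᵘ.mkℚᵘ (+ b) 0   ≃⟨ ℚ.toℚᵘ-fromℚᵘ (ℚᵘ.mkℚᵘ (+ b) 0) ⟨
  toℚᵘ (fromℕ b)    ∎)
  where open ℚᵘ.≤-Reasoning

fromℕ-cancel-≤ : ∀ {a b} → fromℕ a ≤ fromℕ b → a ℕ.≤ b
fromℕ-cancel-≤ {a} {b} h with a ℕ.≤? b
... | yes a≤b = a≤b
... | no a≰b = contradiction (ℚ.<-≤-trans b<1+b (subst (_≤ fromℕ b) (fromℕ-suc b) (ℚ.≤-trans (fromℕ-mono-≤ (ℕ.≰⇒> a≰b)) h))) (ℚ.<-irrefl refl)
  where
  b<1+b : fromℕ b < 1ℚ + fromℕ b
  b<1+b = subst (_< 1ℚ + fromℕ b) (ℚ.+-identityˡ (fromℕ b)) (ℚ.+-monoˡ-< (fromℕ b) (ℚ.positive⁻¹ 1ℚ))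

0≤fromℕ : ∀ a → 0ℚ ≤ fromℕ a
0≤fromℕ a = fromℕ-mono-≤ {0} {a} z≤n

fromℕ-^ : ∀ a k → fromℕ (a ℕ.^ k) ≡ fromℕ a ^ k
fromℕ-^ a zero = refl
fromℕ-^ a (suc k) = trans (fromℕ-* a (a ℕ.^ k)) (cong (fromℕ a *_) (fromℕ-^ a k))

-- The value at 0 keeps `3 * inv u` at least 1 when no untouched vertex is left. On positive
-- arguments the form is the weight occurring in `average`.
inv : ℕ → ℚ
inv zero    = 1ℚ
inv (suc u) = (+ 1) ℚ./ suc u

0≤inv : ∀ u → 0ℚ ≤ inv u
0≤inv zero = 0≤1
0≤inv (suc u) = ℚ.toℚᵘ-cancel-≤ (begin
  toℚᵘ 0ℚ             ≤⟨ ℚᵘ.*≤* (ℤ.+≤+ z≤n) ⟩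
  ℚᵘ.mkℚᵘ (+ 1) u     ≃⟨ ℚ.toℚᵘ-fromℚᵘ (ℚᵘ.mkℚᵘ (+ 1) u) ⟨
  toℚᵘ (inv (suc u))  ∎)
  where open ℚᵘ.≤-Reasoning

fromℕ*inv : ∀ u → fromℕ (suc u) * inv (suc u) ≡ 1ℚ
fromℕ*inv u = ℚ.toℚᵘ-injective (begin
  toℚᵘ (fromℕ (suc u) * inv (suc u))            ≈⟨ ℚ.toℚᵘ-homo-* (fromℕ (suc u)) (inv (suc u)) ⟩
  toℚᵘ (fromℕ (suc u)) ℚᵘ.* toℚᵘ (inv (suc u))
    ≈⟨ ℚᵘ.*-cong (ℚ.toℚᵘ-fromℚᵘ (ℚᵘ.mkℚᵘ (+ suc u) 0)) (ℚ.toℚᵘ-fromℚᵘ (ℚᵘ.mkℚᵘ (+ 1) u)) ⟩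
  ℚᵘ.mkℚᵘ (+ suc u) 0 ℚᵘ.* ℚᵘ.mkℚᵘ (+ 1) u
    ≈⟨ ℚᵘ.*≡* (cong +_ (trans (ℕ.*-identityʳ (suc u ℕ.* 1)) (trans (ℕ.*-identityʳ (suc u)) (sym (trans (ℕ.*-identityˡ (1 ℕ.* suc u)) (ℕ.*-identityˡ (suc u))))))) ⟩
  ℚᵘ.mkℚᵘ (+ 1) 0                               ∎)
  where open ℚᵘ.≃-Reasoning

fromℕ*inv⁺ : ∀ {u} → 0 ℕ.< u → fromℕ u * inv u ≡ 1ℚ
fromℕ*inv⁺ {suc u} _ = fromℕ*inv u

cancel-fromℕ : ∀ u {a b} → fromℕ (suc u) * a ≤ fromℕ (suc u) * b → a ≤ b
cancel-fromℕ u {a} {b} h = subst₂ _≤_ (unit a) (unit b) (*-monoˡ-≤ (0≤inv (suc u)) h)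
  where
  unit : ∀ c → inv (suc u) * (fromℕ (suc u) * c) ≡ c
  unit c = begin
    inv (suc u) * (fromℕ (suc u) * c)
      ≡⟨ solve 3 (λ i f c → i ⊛ (f ⊛ c) := (f ⊛ i) ⊛ c) refl (inv (suc u)) (fromℕ (suc u)) c ⟩
    fromℕ (suc u) * inv (suc u) * c   ≡⟨ cong (_* c) (fromℕ*inv u) ⟩
    1ℚ * c                            ≡⟨ ℚ.*-identityˡ c ⟩
    c                                 ∎
    where open ≡-Reasoning

0≤^ : ∀ {x} → 0ℚ ≤ x → ∀ k → 0ℚ ≤ x ^ k
0≤^ 0≤x zero    = 0≤1
0≤^ 0≤x (suc k) = 0≤* 0≤x (0≤^ 0≤x k)

^-monoˡ-≤ : ∀ {x y} → 0ℚ ≤ x → x ≤ y → ∀ k → x ^ k ≤ y ^ k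
^-monoˡ-≤ 0≤x x≤y zero    = ℚ.≤-refl
^-monoˡ-≤ 0≤x x≤y (suc k) = *-mono-≤ (ℚ.≤-trans 0≤x x≤y) (0≤^ 0≤x k) x≤y (^-monoˡ-≤ 0≤x x≤y k)

1^ : ∀ k → 1ℚ ^ k ≡ 1ℚ
1^ zero    = refl
1^ (suc k) = trans (ℚ.*-identityˡ _) (1^ k)

1≤^ : ∀ {x} → 1ℚ ≤ x → ∀ k → 1ℚ ≤ x ^ k
1≤^ {x} 1≤x k = subst (_≤ x ^ k) (1^ k) (^-monoˡ-≤ 0≤1 1≤x k)

^≤1 : ∀ {x} → 0ℚ ≤ x → x ≤ 1ℚ → ∀ k → x ^ k ≤ 1ℚ
^≤1 {x} 0≤x x≤1 k = subst (x ^ k ≤_) (1^ k) (^-monoˡ-≤ 0≤x x≤1 k)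

^-monoʳ-≤ : ∀ {x} → 1ℚ ≤ x → ∀ {a b} → a ℕ.≤ b → x ^ a ≤ x ^ b
^-monoʳ-≤ {x} 1≤x {b = b} z≤n = 1≤^ 1≤x b
^-monoʳ-≤ {x} 1≤x (s≤s a≤b) = *-monoˡ-≤ (ℚ.≤-trans 0≤1 1≤x) (^-monoʳ-≤ 1≤x a≤b)

^-antimonoʳ-≤ : ∀ {x} → 0ℚ ≤ x → x ≤ 1ℚ → ∀ {a b} → a ℕ.≤ b → x ^ b ≤ x ^ a
^-antimonoʳ-≤ 0≤x x≤1 {b = b} z≤n = ^≤1 0≤x x≤1 b
^-antimonoʳ-≤ 0≤x x≤1 (s≤s a≤b) = *-monoˡ-≤ 0≤x (^-antimonoʳ-≤ 0≤x x≤1 a≤b)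

-- Expectations bounded from below

when : {P : Set} → Dec P → ℚ → ℚ
when (yes _) p = p
when (no _)  p = 0ℚ

module _ {A : Set} where

  total : (A → ℚ) → List A → ℚ
  total f = foldr (λ y s → f y + s) 0ℚ

  average-≥ : ∀ f (xs : List A) {c} → 0 ℕ.< length xs → fromℕ (length xs) * c ≤ total f xs → c ≤ average f xs
  average-≥ f (x ∷ xs) {c} _ h = cancel-fromℕ (length xs) (ℚ.≤-trans h (ℚ.≤-reflexive (sym eq)))
    where
    open ≡-Reasoning
    ℓ = fromℕ (length (x ∷ xs))
    eq : ℓ * (inv (length (x ∷ xs)) * total f (x ∷ xs)) ≡ total f (x ∷ xs)
    eq = begin
      ℓ * (inv (length (x ∷ xs)) * total f (x ∷ xs)) ≡⟨ ℚ.*-assoc ℓ _ _ ⟨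
      ℓ * inv (length (x ∷ xs)) * total f (x ∷ xs)   ≡⟨ cong (_* total f (x ∷ xs)) (fromℕ*inv (length xs)) ⟩
      1ℚ * total f (x ∷ xs)                          ≡⟨ ℚ.*-identityˡ _ ⟩
      total f (x ∷ xs)                               ∎

  -- An expectation bound with denominators cleared: `f` falls short of `c` by at most `p` on `P`
  -- and at most `q` on `Q`. The events may overlap, as they do for damaging edges and edges at the
  -- target.
  total-≥ : {P Q : A → Set} (P? : ∀ x → Dec (P x)) (Q? : ∀ x → Dec (Q x)) {f : A → ℚ} {c p q : ℚ} (xs : List A) →
    (∀ {x} → x ∈ xs → c ≤ f x + (when (P? x) p + when (Q? x) q)) →
    fromℕ (length xs) * c ≤ total f xs + (fromℕ (length (filter P? xs)) * p + fromℕ (length (filter Q? xs)) * q)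
  total-≥ P? Q? {f} {c} {p} {q} [] h = ℚ.≤-reflexive (solve 3 (λ c p q → con 0ℚ ⊛ c
      := con 0ℚ ⊕ (con 0ℚ ⊛ p ⊕ con 0ℚ ⊛ q)) refl c p q)
  total-≥ P? Q? {f} {c} {p} {q} (x ∷ xs) h = begin
    fromℕ (suc (length xs)) * c                  ≡⟨ cong (_* c) (fromℕ-suc (length xs)) ⟩
    (1ℚ + fromℕ (length xs)) * c
      ≡⟨ solve 2 (λ l c → (con 1ℚ ⊕ l) ⊛ c := c ⊕ l ⊛ c) refl (fromℕ (length xs)) c ⟩
    c + fromℕ (length xs) * c
      ≤⟨ ℚ.+-mono-≤ (h (here refl)) (total-≥ P? Q? {f} {c} {p} {q} xs (λ z → h (there z))) ⟩
    (f x + (when (P? x) p + when (Q? x) q)) + (total f xs + (#P * p + #Q * q))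
      ≡⟨ solve 6 (λ a b c d e g → (a ⊕ (b ⊕ c)) ⊕ (d ⊕ (e ⊕ g))
          := (a ⊕ d) ⊕ ((b ⊕ e) ⊕ (c ⊕ g))) refl (f x) (when (P? x) p) (when (Q? x) q) (total f xs) (#P * p) (#Q * q) ⟩
    (f x + total f xs) + ((when (P? x) p + #P * p) + (when (Q? x) q + #Q * q))
      ≡⟨ cong ((f x + total f xs) ℚ.+_) (cong₂ _+_ (count P? p) (count Q? q)) ⟩
    total f (x ∷ xs) + (fromℕ (length (filter P? (x ∷ xs))) * p + fromℕ (length (filter Q? (x ∷ xs))) * q) ∎
    where
    open ℚ.≤-Reasoning
    #P = fromℕ (length (filter P? xs))
    #Q = fromℕ (length (filter Q? xs))
    count : {R : A → Set} (R? : ∀ x → Dec (R x)) (w : ℚ) →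
      when (R? x) w + fromℕ (length (filter R? xs)) * w ≡ fromℕ (length (filter R? (x ∷ xs))) * w
    count R? w with R? x
    ... | yes _ = trans (solve 2 (λ l c → c ⊕ l ⊛ c := (con 1ℚ ⊕ l) ⊛ c) refl (fromℕ (length (filter R? xs))) w)
                        (cong (_* w) (sym (fromℕ-suc (length (filter R? xs)))))
    ... | no _  = ℚ.+-identityˡ _

  average-≥-each : ∀ f (xs : List A) {c} → 0 ℕ.< length xs → (∀ x → c ≤ f x) → c ≤ average f xs
  average-≥-each f xs {c} 0<ℓ h = average-≥ f xs 0<ℓ (go xs)
    where
    go : ∀ xs → fromℕ (length xs) * c ≤ total f xs
    go [] = ℚ.≤-reflexive (ℚ.*-zeroˡ c)
    go (x ∷ xs) = begin
      fromℕ (suc (length xs)) * c   ≡⟨ cong (_* c) (fromℕ-suc (length xs)) ⟩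
      (1ℚ + fromℕ (length xs)) * c  ≡⟨ solve 2 (λ l c → (con 1ℚ ⊕ l) ⊛ c := c ⊕ l ⊛ c) refl (fromℕ (length xs)) c ⟩
      c + fromℕ (length xs) * c     ≤⟨ ℚ.+-mono-≤ (h x) (go xs) ⟩
      total f (x ∷ xs)              ∎
      where open ℚ.≤-Reasoning

-- Growth of the reciprocal of the number of untouched vertices

inv-≤ : ∀ u v {c} → 0 ℕ.< u → 0 ℕ.< v → fromℕ u ≤ fromℕ v * (fromℕ u * c) → inv v ≤ c
inv-≤ (suc u) (suc v) {c} _ _ h = cancel-fromℕ u (cancel-fromℕ v (ℚ.≤-trans (ℚ.≤-reflexive eq) h))
  where
  open ≡-Reasoning
  x = fromℕ (suc u)
  y = fromℕ (suc v)
  i = inv (suc v)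
  eq : y * (x * i) ≡ x
  eq = begin
    y * (x * i)   ≡⟨ solve 3 (λ x y i → y ⊛ (x ⊛ i) := x ⊛ (y ⊛ i)) refl x y i ⟩
    x * (y * i)   ≡⟨ cong (x *_) (fromℕ*inv v) ⟩
    x * 1ℚ        ≡⟨ ℚ.*-identityʳ x ⟩
    x             ∎

inv-antimono : ∀ {u v} → 0 ℕ.< u → u ℕ.≤ v → inv v ≤ inv u
inv-antimono {suc u} {v} 0<u u≤v = inv-≤ (suc u) v 0<u (ℕ.≤-trans 0<u u≤v) (ℚ.≤-trans (fromℕ-mono-≤ u≤v) (ℚ.≤-reflexive
  (sym (trans (cong (fromℕ v *_) (fromℕ*inv u)) (ℚ.*-identityʳ _)))))

-- `1 / (u - 2) - 1 / u = 2 / (u (u - 2))`, and `u - 2 ≥ u / 3` because `u ≥ 3`; this is the source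
-- of the 6.
inv-drop : ∀ {u v} → 3 ℕ.≤ u → u ℕ.≤ 2 ℕ.+ v → inv v ≤ inv u + fromℕ 6 * inv u * inv u
inv-drop {u@(suc u₁)} {v} 3≤u u≤2+v = inv-≤ u v (s≤s z≤n) (ℕ.≤-pred (ℕ.≤-pred (ℕ.≤-trans 3≤u u≤2+v))) (cancel-fromℕ u₁ (begin
  fromℕ u * fromℕ u                                           ≡⟨ fromℕ-* u u ⟨
  fromℕ (u ℕ.* u)                                             ≤⟨ fromℕ-mono-≤ (quadratic u v 3≤u u≤2+v) ⟩
  fromℕ (v ℕ.* (u ℕ.+ 6))
    ≡⟨ trans (fromℕ-* v (u ℕ.+ 6)) (cong (fromℕ v *_) (fromℕ-+ u 6)) ⟩
  fromℕ v * (fromℕ u + fromℕ 6)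
    ≡⟨ solve 3 (λ v u s → v ⊛ (u ⊕ s) := v ⊛ (u ⊛ con 1ℚ ⊕ s ⊛ con 1ℚ ⊛ con 1ℚ)) refl (fromℕ v) (fromℕ u) (fromℕ 6) ⟩
  fromℕ v * (fromℕ u * 1ℚ + fromℕ 6 * 1ℚ * 1ℚ)
    ≡⟨ cong (λ z → fromℕ v * (fromℕ u * z + fromℕ 6 * z * z)) (fromℕ*inv u₁) ⟨
  fromℕ v * (fromℕ u * (fromℕ u * inv u) + fromℕ 6 * (fromℕ u * inv u) * (fromℕ u * inv u))
    ≡⟨ solve 4 (λ v u i s → v ⊛ (u ⊛ (u ⊛ i) ⊕ s ⊛ (u ⊛ i) ⊛ (u ⊛ i))
        := u ⊛ (v ⊛ (u ⊛ (i ⊕ s ⊛ i ⊛ i)))) refl (fromℕ v) (fromℕ u) (inv u) (fromℕ 6) ⟩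
  fromℕ u * (fromℕ v * (fromℕ u * (inv u + fromℕ 6 * inv u * inv u))) ∎))
  where
  open ℚ.≤-Reasoning
  quadratic : ∀ u v → 3 ℕ.≤ u → u ℕ.≤ 2 ℕ.+ v → u ℕ.* u ℕ.≤ v ℕ.* (u ℕ.+ 6)
  quadratic (suc (suc w)) v (s≤s (s≤s 1≤w)) (s≤s (s≤s w≤v)) = ℕ.≤-trans
    (ℕ.≤-trans (ℕ.m≤m+n _ (4 ℕ.* (w ℕ.∸ 1))) (ℕ.≤-reflexive (go w 1≤w))) (ℕ.*-monoˡ-≤ (2 ℕ.+ w ℕ.+ 6) w≤v)
    where
    go : ∀ w → 1 ℕ.≤ w → (2 ℕ.+ w) ℕ.* (2 ℕ.+ w) ℕ.+ 4 ℕ.* (w ℕ.∸ 1) ≡ w ℕ.* (2 ℕ.+ w ℕ.+ 6)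
    go (suc w) _ = N.solve 1 (λ w → (N.con 3 N.:+ w) N.:* (N.con 3 N.:+ w) N.:+ N.con 4 N.:* w
        N.:= (N.con 1 N.:+ w) N.:* (N.con 3 N.:+ w N.:+ N.con 6)) refl w

-- The game under the first-untouched-vertex strategy

module Play (n m : ℕ) (σ : Strategy n) where
  open Game n m σ
  open Board n

  -- This and the next lemmas restate the clauses of the game as equations, so that later proofs
  -- need not repeat its case distinctions.
  breakerTurn-stuck : ∀ f B M → unclaimed n B M ≡ [] → breakerTurn (suc f) B M ≡ indicator (BreakerIsolates n B)
  breakerTurn-stuck f B M eq with unclaimed n B M
  breakerTurn-stuck f B M refl | [] = refl

  breakerTurn-legal : ∀ f B M → σ B M ∈ unclaimed n B M → breakerTurn (suc f) B M ≡ makerTurn m f (σ B M ∷ B) M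
  breakerTurn-legal f B M p with unclaimed n B M in eq
  ... | e ∷ U with σ B M ∈? unclaimed n B M
  ...   | yes _ = refl
  ...   | no ¬p = contradiction (subst (σ B M ∈_) (sym eq) p) ¬p

  breakerTurn-illegal : ∀ f B M → 0 ℕ.< length (unclaimed n B M) → ¬ (σ B M ∈ unclaimed n B M) → breakerTurn (suc f) B M ≡ 0ℚ
  breakerTurn-illegal f B M 0<ℓ ¬p with unclaimed n B M in eq
  ... | e ∷ U with σ B M ∈? unclaimed n B M
  ...   | yes p = contradiction (subst (σ B M ∈_) eq p) ¬p
  ...   | no _  = refl

  makerTurn-stuck : ∀ k f B M → unclaimed n B M ≡ [] → makerTurn (suc k) f B M ≡ breakerTurn f B M
  makerTurn-stuck k f B M eq with unclaimed n B M
  makerTurn-stuck k f B M refl | [] = refl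

  makerTurn-average : ∀ k f B M → 0 ℕ.< length (unclaimed n B M) →
    makerTurn (suc k) f B M ≡ average (λ e → makerTurn k f B (e ∷ M)) (unclaimed n B M)
  makerTurn-average k f B M 0<ℓ with unclaimed n B M
  ... | e ∷ U = refl

  stuck-or-not : ∀ B M → unclaimed n B M ≡ [] ⊎ 0 ℕ.< length (unclaimed n B M)
  stuck-or-not B M with unclaimed n B M
  ... | []    = inj₁ refl
  ... | _ ∷ _ = inj₂ (s≤s z≤n)

  0≤indicator : ∀ b → 0ℚ ≤ indicator b
  0≤indicator true  = 0≤1
  0≤indicator false = ℚ.≤-refl

  mutual
    0≤breakerTurn : ∀ f B M → 0ℚ ≤ breakerTurn f B M
    0≤breakerTurn zero B M = 0≤indicator (BreakerIsolates n B)
    0≤breakerTurn (suc f) B M with stuck-or-not B M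
    ... | inj₁ eq = subst (0ℚ ≤_) (sym (breakerTurn-stuck f B M eq)) (0≤indicator (BreakerIsolates n B))
    ... | inj₂ 0<ℓ with σ B M ∈? unclaimed n B M
    ...   | yes p = subst (0ℚ ≤_) (sym (breakerTurn-legal f B M p)) (0≤makerTurn m f (σ B M ∷ B) M)
    ...   | no ¬p = ℚ.≤-reflexive (sym (breakerTurn-illegal f B M 0<ℓ ¬p))

    0≤makerTurn : ∀ k f B M → 0ℚ ≤ makerTurn k f B M
    0≤makerTurn zero f B M = 0≤breakerTurn f B M
    0≤makerTurn (suc k) f B M with stuck-or-not B M
    ... | inj₁ eq = subst (0ℚ ≤_) (sym (makerTurn-stuck k f B M eq)) (0≤breakerTurn f B M)
    ... | inj₂ 0<ℓ = subst (0ℚ ≤_) (sym (makerTurn-average k f B M 0<ℓ))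
                       (average-≥-each _ (unclaimed n B M) 0<ℓ (λ e → 0≤makerTurn k f B (e ∷ M)))

  Isolated : List (Edge n) → Fin n → Set
  Isolated B v = ∀ {e} → e ∈ allEdges n → Touches v e → e ∈ B

  isolated⇒indicator≡1 : ∀ {B v} → Isolated B v → indicator (BreakerIsolates n B) ≡ 1ℚ
  isolated⇒indicator≡1 {B} {v} iso = cong indicator (trans (isYes≗does w?) (dec-true w? witness))
    where
    w? = Any.any? (λ v → All.all? (λ e → e ∈? B) (incident n v)) (allFin n)
    witness : Any (λ v → All (_∈ B) (incident n v)) (allFin n)
    witness = lose (∈-allFin v) (All.tabulate λ p → let e∈E , t = ∈-filter⁻ (touches? v) {xs = allEdges n} p in iso e∈E t)

  module _ (legal : ∀ B M → 0 ℕ.< length (unclaimed n B M) → σ B M ∈ unclaimed n B M) where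
    mutual
      -- Isolation persists because Breaker's edges only accumulate, but the game runs on to its end
      -- and an illegal move would forfeit it; hence the hypothesis `legal`.
      isolated⇒1≤breakerTurn : ∀ {v} f B M → Isolated B v → 1ℚ ≤ breakerTurn f B M
      isolated⇒1≤breakerTurn zero B M iso = ℚ.≤-reflexive (sym (isolated⇒indicator≡1 iso))
      isolated⇒1≤breakerTurn (suc f) B M iso with stuck-or-not B M
      ... | inj₁ eq = ℚ.≤-reflexive (sym (trans (breakerTurn-stuck f B M eq) (isolated⇒indicator≡1 iso)))
      ... | inj₂ 0<ℓ = subst (1ℚ ≤_) (sym (breakerTurn-legal f B M (legal B M 0<ℓ)))
                         (isolated⇒1≤makerTurn m f (σ B M ∷ B) M (λ p t → there (iso p t)))

      isolated⇒1≤makerTurn : ∀ {v} k f B M → Isolated B v → 1ℚ ≤ makerTurn k f B M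
      isolated⇒1≤makerTurn zero f B M iso = isolated⇒1≤breakerTurn f B M iso
      isolated⇒1≤makerTurn (suc k) f B M iso with stuck-or-not B M
      ... | inj₁ eq = subst (1ℚ ≤_) (sym (makerTurn-stuck k f B M eq)) (isolated⇒1≤breakerTurn f B M iso)
      ... | inj₂ 0<ℓ = subst (1ℚ ≤_) (sym (makerTurn-average k f B M 0<ℓ))
                         (average-≥-each _ (unclaimed n B M) 0<ℓ (λ e → isolated⇒1≤makerTurn k f B (e ∷ M) iso))

-- Backward induction on the potential

-- One random Maker edge, as pure algebra. `L` is the number of unclaimed edges, `S` the sum of the
-- winning probabilities after each of them, `P` the total damage to the term `T`, and `Q` the
-- number of edges hitting the target. The slack in `γ` is weighted by `T` and the slack in `b` by
-- `W * g`, after which all terms cancel.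
potential-step : ∀ {L S T W g γ b ν r P Q} → 0ℚ ≤ T → 0ℚ ≤ W → 0ℚ ≤ g →
  L * (1ℚ - (T + W * (1ℚ - g))) ≤ S + (P + Q * (W * g)) → P ≤ T * ν → Q ≤ r →
  L + ν ≤ L * γ → r + L * b ≤ L →
  L * (1ℚ - (T * γ + W * (1ℚ - b * g))) ≤ S
potential-step {L} {S} {T} {W} {g} {γ} {b} {ν} {r} {P} {Q} 0≤T 0≤W 0≤g h hP hQ hγ hb =
  ≤-by (0≤+ (0≤- h) (0≤+ (0≤- hP) (0≤+ (0≤* (0≤* 0≤W 0≤g) (0≤- hQ)) (0≤+ (0≤* 0≤T (0≤- hγ)) (0≤* (0≤* 0≤W 0≤g) (0≤- hb))))))
    (solve 11 (λ L S T W g γ b ν r P Q →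
      L ⊛ (con 1ℚ ⊖ (T ⊛ γ ⊕ W ⊛ (con 1ℚ ⊖ b ⊛ g))) ⊕
        ((S ⊕ (P ⊕ Q ⊛ (W ⊛ g)) ⊖ L ⊛ (con 1ℚ ⊖ (T ⊕ W ⊛ (con 1ℚ ⊖ g)))) ⊕
         ((T ⊛ ν ⊖ P) ⊕ (W ⊛ g ⊛ (r ⊖ Q) ⊕ (T ⊛ (L ⊛ γ ⊖ (L ⊕ ν)) ⊕ W ⊛ g ⊛ (L ⊖ (r ⊕ L ⊛ b))))))
      := S) refl L S T W g γ b ν r P Q)

-- `E` is the number of edges guaranteed to be unclaimed while tries last. The last two hypotheses
-- say `1 + 6 n / L ≤ γ` and `β ^ r ≤ 1 - r / L`, uniformly over such boards.
module Analysis (n m : ℕ) (e₀ : Edge n) (E : ℕ) (0<E : 0 ℕ.< E) (γ β : ℚ) (1≤γ : 1ℚ ≤ γ) (0≤β : 0ℚ ≤ β) (β≤1 : β ≤ 1ℚ)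
  (γ-growth : ∀ L → E ℕ.≤ L → fromℕ L + fromℕ 6 * fromℕ n ≤ fromℕ L * γ)
  (β-decay : ∀ L r → E ℕ.≤ L → r ℕ.≤ n → fromℕ r + fromℕ L * β ^ r ≤ fromℕ L) where

  open Board n

  candidates : List (Fin n) → List (Edge n) → List (Edge n) → List (Edge n)
  candidates []      B M = []
  candidates (v ∷ _) B M = freeAt v B M

  -- Appending all unclaimed edges keeps the strategy legal once the target is isolated or no
  -- untouched vertex remains; `e₀` is returned only on a full board.
  strategy : Strategy n
  strategy B M = headOr e₀ (candidates (untouched M) B M ++ unclaimed n B M)

  strategy-legal : ∀ B M → 0 ℕ.< length (unclaimed n B M) → strategy B M ∈ unclaimed n B M
  strategy-legal B M 0<ℓ with ∈-++⁻ (candidates (untouched M) B M) (headOr-∈ e₀ (candidates (untouched M) B M ++ unclaimed n B M)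
    (ℕ.≤-trans 0<ℓ (ℕ.≤-trans (ℕ.m≤n+m _ (length (candidates (untouched M) B M))) (ℕ.≤-reflexive (sym (length-++ (candidates (untouched M) B M)))))))
  ... | inj₂ p = p
  ... | inj₁ p = go (untouched M) p
    where
    go : ∀ vs {e} → e ∈ candidates vs B M → e ∈ unclaimed n B M
    go (v ∷ _) p = proj₁ (∈-freeAt⁻ {v} {B} {M} p)

  strategy-target : ∀ {B M v vs} → untouched M ≡ v ∷ vs → 0 ℕ.< length (freeAt v B M) → strategy B M ∈ freeAt v B M
  strategy-target {B} {M} {v} eq 0<ℓ = subst (λ us → headOr e₀ (candidates us B M ++ unclaimed n B M) ∈ freeAt v B M) (sym eq)
    (headOr-++ e₀ (unclaimed n B M) 0<ℓ)

  open Game n m strategy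
  open Play n m strategy

  -- Throughout, j is the number of further tries, r bounds the number of free edges at the current target, k is the
  -- number of edges Maker still claims in this round, and u is the number of untouched vertices.
  -- steps bounds the number of edges Maker claims until all tries are over.
  steps : ℕ → ℕ → ℕ → ℕ
  steps j r k = k ℕ.+ (j ℕ.* (m ℕ.* n) ℕ.+ m ℕ.* r)

  -- `m (0 + 1 + ... + (r - 1))`: Breaker moves first, so Maker's `m` edges meet one free edge less
  -- than there were at the start of the round.
  tri : ℕ → ℕ
  tri zero    = 0
  tri (suc r) = m ℕ.* r ℕ.+ tri r

  -- Each Maker edge costs a factor β per free edge at the target: the current try succeeds with probability ≥ β ^ hazard.
  hazard : ℕ → ℕ → ℕ
  hazard r k = k ℕ.* r ℕ.+ tri r

  -- The worst case for a new try: a target is adopted in the middle of a round, with at most `m`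
  -- Maker edges to come in it and at most `n` free edges at the vertex.
  q w : ℚ
  q = β ^ hazard n m
  w = 1ℚ - q

  0≤w : 0ℚ ≤ w
  0≤w = 0≤- (^≤1 0≤β β≤1 (hazard n m))

  -- The first summand bounds the probability that the untouched vertices run out (it exceeds 1 when u ≤ 2), the second
  -- one the probability that all tries fail.
  loss : ℕ → ℕ → ℕ → ℕ → ℚ
  loss j r k u = fromℕ 3 * inv u * γ ^ steps j r k + w ^ j * (1ℚ - β ^ hazard r k)

  0≤γ^ : ∀ s → 0ℚ ≤ γ ^ s
  0≤γ^ = 0≤^ (ℚ.≤-trans 0≤1 1≤γ)

  0≤3inv : ∀ u → 0ℚ ≤ fromℕ 3 * inv u
  0≤3inv u = 0≤* (0≤fromℕ 3) (0≤inv u)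

  few⇒1≤loss : ∀ j r k {u} → u ℕ.≤ 2 → 1ℚ ≤ loss j r k u
  few⇒1≤loss j r k {u} u≤2 = begin
    1ℚ                                    ≡⟨⟩
    1ℚ * 1ℚ + 0ℚ                          ≤⟨ ℚ.+-mono-≤ (*-mono-≤ (0≤3inv u) 0≤1 (1≤3inv u≤2) (1≤^ 1≤γ (steps j r k)))
                                               (0≤* (0≤^ 0≤w j) (0≤- (^≤1 0≤β β≤1 (hazard r k)))) ⟩
    loss j r k u                          ∎
    where
    open ℚ.≤-Reasoning
    1≤3inv : ∀ {u} → u ℕ.≤ 2 → 1ℚ ≤ fromℕ 3 * inv u
    1≤3inv z≤n             = ℚ.*≤* (ℤ.+≤+ (s≤s z≤n))
    1≤3inv (s≤s z≤n)       = ℚ.*≤* (ℤ.+≤+ (s≤s z≤n))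
    1≤3inv (s≤s (s≤s z≤n)) = ℚ.*≤* (ℤ.+≤+ (s≤s (s≤s z≤n)))

  -- `room` reserves an edge for every claim still to come from Maker (`steps`) and from Breaker
  -- (`j * n + r`), so at least `E` edges remain until all tries are over.
  record Invariant (j r k : ℕ) (B M : List (Edge n)) : Set where
    field
      room  : E ℕ.+ (steps j r k ℕ.+ (j ℕ.* n ℕ.+ r)) ℕ.≤ length (unclaimed n B M)
      quota : ∀ {v vs} → untouched M ≡ v ∷ vs → length (freeAt v B M) ℕ.≤ r
      r≤n   : r ℕ.≤ n
      k≤m   : k ℕ.≤ m
  open Invariant

  U : List (Edge n) → ℕ
  U M = length (untouched M)

  afterBreaker : ∀ {j r B M v vs} → Invariant j (suc r) 0 B M → untouched M ≡ v ∷ vs → 0 ℕ.< length (freeAt v B M) →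
    Invariant j r m (strategy B M ∷ B) M
  afterBreaker {j} {r} {B} {M} {v} I eq 0<ℓ .room = ℕ.≤-pred (begin
    suc (E ℕ.+ (steps j r m ℕ.+ (j ℕ.* n ℕ.+ r)))
      ≡⟨ N.solve 6 (λ E m a r b n → N.con 1 N.:+ (E N.:+ ((m N.:+ (a N.:+ m N.:* r)) N.:+ (b N.:+ r)))
          N.:= E N.:+ ((a N.:+ m N.:* (N.con 1 N.:+ r)) N.:+ (b N.:+ (N.con 1 N.:+ r)))) refl E m (j ℕ.* (m ℕ.* n)) r (j ℕ.* n) n ⟩
    E ℕ.+ (steps j (suc r) 0 ℕ.+ (j ℕ.* n ℕ.+ suc r))    ≤⟨ room I ⟩
    length (unclaimed n B M)                             ≤⟨ unclaimed-Breaker B M (strategy B M) ⟩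
    suc (length (unclaimed n (strategy B M ∷ B) M))      ∎)
    where open ℕ.≤-Reasoning
  afterBreaker {j} {r} {B} {M} {v} I eq 0<ℓ .quota eq′ with trans (sym eq) eq′
  ... | refl = ℕ.≤-pred (ℕ.≤-trans (freeAt-Breaker {v} {B} {M} (strategy-target {B} {M} eq 0<ℓ)) (quota I eq))
  afterBreaker I eq 0<ℓ .r≤n = ℕ.≤-trans (ℕ.n≤1+n _) (r≤n I)
  afterBreaker I eq 0<ℓ .k≤m = ℕ.≤-refl

  afterMiss : ∀ {j r k B M v vs e} → Invariant j r (suc k) B M → untouched M ≡ v ∷ vs → ¬ Touches v e →
    Invariant j r k B (e ∷ M)
  afterMiss {j} {r} {k} {B} {M} {e = e} I eq ¬t .room = ℕ.≤-pred (begin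
    suc (E ℕ.+ (steps j r k ℕ.+ (j ℕ.* n ℕ.+ r)))  ≡⟨ ℕ.+-suc E _ ⟨
    E ℕ.+ (steps j r (suc k) ℕ.+ (j ℕ.* n ℕ.+ r))  ≤⟨ room I ⟩
    length (unclaimed n B M)                       ≤⟨ unclaimed-Maker B M e ⟩
    suc (length (unclaimed n B (e ∷ M)))           ∎)
    where open ℕ.≤-Reasoning
  afterMiss {B = B} {M} {v} {e = e} I eq ¬t .quota eq′ with target-stable {M} {e} eq ¬t
  ... | vs′ , eq″ with trans (sym eq″) eq′
  ... | refl = ℕ.≤-trans (freeAt-Maker v B M e) (quota I eq)
  afterMiss I eq ¬t .r≤n = r≤n I
  afterMiss I eq ¬t .k≤m = ℕ.≤-trans (ℕ.n≤1+n _) (k≤m I)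

  steps-renew : ∀ j r k → steps j n k ℕ.≤ steps (suc j) r k
  steps-renew j r k = ℕ.+-monoʳ-≤ k (begin
    j ℕ.* (m ℕ.* n) ℕ.+ m ℕ.* n                ≡⟨ ℕ.+-comm (j ℕ.* (m ℕ.* n)) _ ⟩
    suc j ℕ.* (m ℕ.* n)                        ≤⟨ ℕ.m≤m+n _ _ ⟩
    suc j ℕ.* (m ℕ.* n) ℕ.+ m ℕ.* r            ∎)
    where open ℕ.≤-Reasoning

  moves-renew : ∀ j r → j ℕ.* n ℕ.+ n ℕ.≤ suc j ℕ.* n ℕ.+ r
  moves-renew j r = ℕ.≤-trans (ℕ.≤-reflexive (ℕ.+-comm (j ℕ.* n) n)) (ℕ.m≤m+n _ r)

  -- The next target may have up to `n` free edges, so the bound is reset to `n`; the budget of the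
  -- consumed try pays for this.
  afterHit : ∀ {j r k B M e} → Invariant (suc j) r (suc k) B M → Invariant j n k B (e ∷ M)
  afterHit {j} {r} {k} {B} {M} {e} I .room = ℕ.≤-pred (begin
    suc (E ℕ.+ (steps j n k ℕ.+ (j ℕ.* n ℕ.+ n)))              ≡⟨ ℕ.+-suc E _ ⟨
    E ℕ.+ (suc (steps j n k) ℕ.+ (j ℕ.* n ℕ.+ n))
      ≤⟨ ℕ.+-monoʳ-≤ E (ℕ.+-mono-≤ (s≤s (steps-renew j r k)) (moves-renew j r)) ⟩
    E ℕ.+ (steps (suc j) r (suc k) ℕ.+ (suc j ℕ.* n ℕ.+ r))    ≤⟨ room I ⟩
    length (unclaimed n B M)                                   ≤⟨ unclaimed-Maker B M e ⟩
    suc (length (unclaimed n B (e ∷ M)))                       ∎)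
    where open ℕ.≤-Reasoning
  afterHit {B = B} {M} {e} I .quota {v} _ = freeAt≤n v B (e ∷ M)
  afterHit I .r≤n = ℕ.≤-refl
  afterHit I .k≤m = ℕ.≤-trans (ℕ.n≤1+n _) (k≤m I)

  scarcity : ℕ → ℕ → ℚ
  scarcity u s = fromℕ 3 * inv u * γ ^ s

  0≤scarcity : ∀ u s → 0ℚ ≤ scarcity u s
  0≤scarcity u s = 0≤* (0≤3inv u) (0≤γ^ s)

  scarcity-step : ∀ M e s → 3 ℕ.≤ U M →
    scarcity (U (e ∷ M)) s ≤ scarcity (U M) s + when (damaging? M e) (scarcity (U M) s * (fromℕ 6 * inv (U M)))
  scarcity-step M e s 3≤U with damaging? M e
  ... | no ¬d = ℚ.≤-trans (*-mono-≤ (0≤3inv (U M)) (0≤γ^ s) (*-monoˡ-≤ (0≤fromℕ 3)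
          (inv-antimono (ℕ.≤-trans (s≤s z≤n) 3≤U) (untouched-harmless M e ¬d))) ℚ.≤-refl) (ℚ.≤-reflexive (sym (ℚ.+-identityʳ _)))
  ... | yes _ = begin
    fromℕ 3 * inv (U (e ∷ M)) * γ ^ s
      ≤⟨ *-mono-≤ (0≤* (0≤fromℕ 3) (0≤+ (0≤inv (U M)) (0≤* (0≤* (0≤fromℕ 6) (0≤inv (U M))) (0≤inv (U M))))) (0≤γ^ s)
                                            (*-monoˡ-≤ (0≤fromℕ 3) (inv-drop 3≤U (untouched-step M e))) ℚ.≤-refl ⟩
    fromℕ 3 * (inv (U M) + fromℕ 6 * inv (U M) * inv (U M)) * γ ^ s
      ≡⟨ solve 4 (λ t i s g → t ⊛ (i ⊕ s ⊛ i ⊛ i) ⊛ g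
          := t ⊛ i ⊛ g ⊕ t ⊛ i ⊛ g ⊛ (s ⊛ i)) refl (fromℕ 3) (inv (U M)) (fromℕ 6) (γ ^ s) ⟩
    scarcity (U M) s + scarcity (U M) s * (fromℕ 6 * inv (U M)) ∎
    where open ℚ.≤-Reasoning

  0≤when : ∀ {P : Set} (d : Dec P) {p} → 0ℚ ≤ p → 0ℚ ≤ when d p
  0≤when (yes _) 0≤p = 0≤p
  0≤when (no _)  _   = ℚ.≤-refl

  trivial : ∀ {l} → 1ℚ ≤ l → 1ℚ - l ≤ 0ℚ
  trivial 1≤l = ℚ.≤-trans (ℚ.+-monoʳ-≤ 1ℚ (ℚ.neg-antimono-≤ 1≤l)) (ℚ.≤-reflexive (ℚ.+-inverseʳ 1ℚ))

  nonempty : ∀ {A : Set} {xs : List A} → 0 ℕ.< length xs → ∃ λ x → ∃ λ ys → xs ≡ x ∷ ys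
  nonempty {xs = x ∷ xs} _ = x , xs , refl

  mutual
    -- The fuel need only cover Breaker's moves up to the end of the last try, at most `n` per try.
    breakerBound : ∀ f B M j r → Invariant j r 0 B M → j ℕ.* n ℕ.+ r ℕ.≤ f → 1ℚ - loss j r 0 (U M) ≤ breakerTurn f B M
    breakerBound f B M j r I fuel with untouched M in eq
    ... | [] = ℚ.≤-trans (trivial (few⇒1≤loss j r 0 {0} z≤n)) (0≤breakerTurn f B M)
    ... | v ∷ vs with freeAt v B M in eqF
    -- No edge at the target is free and Maker has none there, so Breaker owns them all and has won.
    ...   | [] = ℚ.≤-trans (≤-by {d = loss j r 0 (suc (length vs))} (0≤+ (0≤scarcity (suc (length vs)) (steps j r 0)) (0≤* (0≤^ 0≤w j) (0≤- (^≤1 0≤β β≤1 (hazard r 0)))))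
               (solve 1 (λ l → con 1ℚ ⊖ l ⊕ l := con 1ℚ) refl (loss j r 0 (suc (length vs)))))
               (isolated⇒1≤breakerTurn strategy-legal f B M isolated)
      where
      isolated : Isolated B v
      isolated {e} e∈E t with e ∈? B
      ... | yes e∈B = e∈B
      ... | no e∉B = contradiction (subst (e ∈_) eqF (∈-filter⁺ (touches? v) (∈-unclaimed⁺ {B} {M} e∈E e∉B
              (λ e∈M → ∈-untouched⁻ {M} (subst (v ∈_) (sym eq) (here refl)) (lose e∈M t))) t)) λ ()
    ...   | x ∷ xs = play r f I fuel
      where
      0<ℓ : 0 ℕ.< length (freeAt v B M)
      0<ℓ = subst (λ ys → 0 ℕ.< length ys) (sym eqF) (s≤s z≤n)
      play : ∀ r f → Invariant j r 0 B M → j ℕ.* n ℕ.+ r ℕ.≤ f → 1ℚ - loss j r 0 (suc (length vs)) ≤ breakerTurn f B M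
      play zero f I fuel = contradiction (ℕ.≤-trans 0<ℓ (quota I eq)) λ ()
      play (suc r) zero I fuel = contradiction (ℕ.≤-trans (ℕ.m≤n+m (suc r) (j ℕ.* n)) fuel) λ ()
      -- Breaker's move leaves the potential unchanged: `hazard (suc r) 0` and `hazard r m` agree by
      -- computation, the two values of `steps` after rearrangement.
      play (suc r) (suc f) I fuel = subst₂ _≤_
        (cong (λ l → 1ℚ - l) (cong₂ (λ u s → scarcity u s + w ^ j * (1ℚ - β ^ hazard r m)) (cong length eq)
          (N.solve 3 (λ m a r → m N.:+ (a N.:+ m N.:* r)
              N.:= a N.:+ m N.:* (N.con 1 N.:+ r)) refl m (j ℕ.* (m ℕ.* n)) r)))
        (sym (breakerTurn-legal f B M (proj₁ (∈-freeAt⁻ {v} {B} {M} (strategy-target {B} {M} eq 0<ℓ)))))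
        (makerBound m f (strategy B M ∷ B) M j r (afterBreaker I eq 0<ℓ) (ℕ.≤-pred (ℕ.≤-trans (ℕ.≤-reflexive (sym (ℕ.+-suc (j ℕ.* n) r))) fuel)))

    makerBound : ∀ k f B M j r → Invariant j r k B M → j ℕ.* n ℕ.+ r ℕ.≤ f → 1ℚ - loss j r k (U M) ≤ makerTurn k f B M
    makerBound zero f B M j r I fuel = breakerBound f B M j r I fuel
    makerBound (suc k) f B M j r I fuel with 3 ℕ.≤? U M
    ... | no U≱3 = ℚ.≤-trans (trivial (few⇒1≤loss j r (suc k) (ℕ.≤-pred (ℕ.≰⇒> U≱3)))) (0≤makerTurn (suc k) f B M)
    ... | yes 3≤U with nonempty (ℕ.≤-trans (s≤s z≤n) 3≤U)
    ... | v , vs , eq = subst₂ _≤_ (cong (λ l → 1ℚ - l) (sym expand)) (sym (makerTurn-average k f B M (ℕ.≤-trans 0<E E≤L)))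
        (average-≥ f′ Un (ℕ.≤-trans 0<E E≤L)
          (potential-step (0≤scarcity (U M) s) (0≤^ 0≤w j) (0≤^ 0≤β (hazard r k))
            (total-≥ (damaging? M) (touches? v) {f′} Un (λ {e} _ → each e))
            damage (fromℕ-mono-≤ (quota I eq)) (γ-growth L E≤L) (β-decay L r E≤L (r≤n I))))
      where
      Un = unclaimed n B M
      L = length Un
      s = steps j r k
      f′ : Edge n → ℚ
      f′ e = makerTurn k f B (e ∷ M)
      T = scarcity (U M) s
      W = w ^ j
      g = β ^ hazard r k
      p = T * (fromℕ 6 * inv (U M))

      E≤L : E ℕ.≤ L
      E≤L = ℕ.≤-trans (ℕ.m≤m+n E _) (room I)

      expand : loss j r (suc k) (U M) ≡ T * γ + W * (1ℚ - β ^ r * g)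
      expand = cong₂ _+_
        (solve 4 (λ t i x y → t ⊛ i ⊛ (x ⊛ y) := t ⊛ i ⊛ y ⊛ x) refl (fromℕ 3) (inv (U M)) γ (γ ^ s))
        (cong (λ z → W * (1ℚ - z)) (trans (cong (β ^_) (ℕ.+-assoc r (k ℕ.* r) (tri r))) (^-homo-* β r (hazard r k))))

      damage : fromℕ (length (filter (damaging? M) Un)) * p ≤ T * (fromℕ 6 * fromℕ n)
      damage = begin
        fromℕ (length (filter (damaging? M) Un)) * p
          ≤⟨ *-mono-≤ (0≤fromℕ (U M ℕ.* n)) 0≤p (fromℕ-mono-≤ (damaging-count B M)) ℚ.≤-refl ⟩
        fromℕ (U M ℕ.* n) * p                        ≡⟨ cong (_* p) (fromℕ-* (U M) n) ⟩
        fromℕ (U M) * fromℕ n * p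
          ≡⟨ solve 5 (λ u n t s i → u ⊛ n ⊛ (t ⊛ (s ⊛ i))
              := t ⊛ (s ⊛ n) ⊛ (u ⊛ i)) refl (fromℕ (U M)) (fromℕ n) T (fromℕ 6) (inv (U M)) ⟩
        T * (fromℕ 6 * fromℕ n) * (fromℕ (U M) * inv (U M))
          ≡⟨ cong (T * (fromℕ 6 * fromℕ n) *_) (fromℕ*inv⁺ (ℕ.≤-trans (s≤s z≤n) 3≤U)) ⟩
        T * (fromℕ 6 * fromℕ n) * 1ℚ                 ≡⟨ ℚ.*-identityʳ _ ⟩
        T * (fromℕ 6 * fromℕ n)                      ∎
        where
        open ℚ.≤-Reasoning
        0≤p : 0ℚ ≤ p
        0≤p = 0≤* (0≤scarcity (U M) s) (0≤* (0≤fromℕ 6) (0≤inv (U M)))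

      each : ∀ e → 1ℚ - (T + W * (1ℚ - g)) ≤ f′ e + (when (damaging? M e) p + when (touches? v e) (W * g))
      each e with touches? v e
      ... | no ¬t = ≤-by (0≤+ (0≤- (makerBound k f B (e ∷ M) j r (afterMiss I eq ¬t) fuel)) (0≤- (scarcity-step M e s 3≤U)))
            (solve 5 (λ T V x d T′ → con 1ℚ ⊖ (T ⊕ V) ⊕ ((x ⊖ (con 1ℚ ⊖ (T′ ⊕ V))) ⊕ ((T ⊕ d) ⊖ T′))
                := x ⊕ (d ⊕ con 0ℚ)) refl
              T (W * (1ℚ - g)) (f′ e) (when (damaging? M e) p) (scarcity (U (e ∷ M)) s))
      ... | yes t = hit j I fuel
        where
        hit : ∀ j → Invariant j r (suc k) B M → j ℕ.* n ℕ.+ r ℕ.≤ f →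
          1ℚ - (scarcity (U M) (steps j r k) + w ^ j * (1ℚ - g)) ≤
          f′ e + (when (damaging? M e) (scarcity (U M) (steps j r k) * (fromℕ 6 * inv (U M))) + w ^ j * g)
        -- The last try is lost. Here `w ^ 0 = 1`, and the claim follows from non-negativity of the
        -- winning probability.
        hit zero I fuel = ≤-by (0≤+ (0≤makerTurn k f B (e ∷ M)) (0≤+ (0≤scarcity (U M) s₀) (0≤when (damaging? M e) (0≤* (0≤scarcity (U M) s₀) (0≤* (0≤fromℕ 6) (0≤inv (U M)))))))
          (solve 4 (λ T x d g → con 1ℚ ⊖ (T ⊕ con 1ℚ ⊛ (con 1ℚ ⊖ g)) ⊕ (x ⊕ (T ⊕ d)) := x ⊕ (d ⊕ con 1ℚ ⊛ g)) refl
            (scarcity (U M) s₀) (f′ e) (when (damaging? M e) (scarcity (U M) s₀ * (fromℕ 6 * inv (U M)))) g)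
          where s₀ = steps 0 r k
        -- The new try succeeds with a probability bounded by `h ≥ q`, since `k ≤ m`. Hence
        -- `w ^ j * (1 - h) ≤ w ^ j * (1 - q)`, which is the old term plus `w ^ suc j * g`.
        hit (suc j) I fuel = ≤-by
          (0≤+ (0≤- (makerBound k f B (e ∷ M) j n (afterHit I) (ℕ.≤-trans (moves-renew j r) fuel)))
            (0≤+ (0≤- (ℚ.≤-trans (*-monoˡ-≤ (0≤3inv (U (e ∷ M))) (^-monoʳ-≤ 1≤γ (steps-renew j r k))) (scarcity-step M e s₁ 3≤U)))
              (0≤* (0≤^ 0≤w j) (0≤- (^-antimonoʳ-≤ 0≤β β≤1 (ℕ.+-monoˡ-≤ (tri n) (ℕ.*-monoˡ-≤ n (ℕ.≤-trans (ℕ.n≤1+n k) (k≤m I)))))))))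
          (solve 8 (λ T V g x d T″ h q → con 1ℚ ⊖ (T ⊕ ((con 1ℚ ⊖ q) ⊛ V) ⊛ (con 1ℚ ⊖ g)) ⊕
              ((x ⊖ (con 1ℚ ⊖ (T″ ⊕ V ⊛ (con 1ℚ ⊖ h)))) ⊕ (((T ⊕ d) ⊖ T″) ⊕ V ⊛ (h ⊖ q)))
              := x ⊕ (d ⊕ ((con 1ℚ ⊖ q) ⊛ V) ⊛ g)) refl
            (scarcity (U M) s₁) (w ^ j) g (f′ e) (when (damaging? M e) (scarcity (U M) s₁ * (fromℕ 6 * inv (U M))))
            (scarcity (U (e ∷ M)) (steps j n k)) (β ^ hazard n k) q)
          where s₁ = steps (suc j) r k

-- Powers of 1 + 1/X

-- A rational substitute for `(1 - q) ^ k ≤ exp (- k q)`; each step loses `(1 + k) q²`.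
bernoulli-decay : ∀ {q} → 0ℚ ≤ q → q ≤ 1ℚ → ∀ k → (1ℚ - q) ^ k * (1ℚ + fromℕ k * q) ≤ 1ℚ
bernoulli-decay {q} 0≤q q≤1 zero = ℚ.≤-reflexive (solve 1 (λ q → con 1ℚ ⊛ (con 1ℚ ⊕ con 0ℚ ⊛ q) := con 1ℚ) refl q)
bernoulli-decay {q} 0≤q q≤1 (suc k) = begin
  (1ℚ - q) * x * (1ℚ + fromℕ (suc k) * q) ≡⟨ cong (λ z → (1ℚ - q) * x * (1ℚ + z * q)) (fromℕ-suc k) ⟩
  (1ℚ - q) * x * (1ℚ + (1ℚ + y) * q)      ≤⟨ ≤-by (0≤* (0≤* (0≤^ (0≤- q≤1) k) (0≤+ 0≤1 (0≤fromℕ k))) (0≤* 0≤q 0≤q))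
    (solve 3 (λ q x y → (con 1ℚ ⊖ q) ⊛ x ⊛ (con 1ℚ ⊕ (con 1ℚ ⊕ y) ⊛ q) ⊕ x ⊛ (con 1ℚ ⊕ y) ⊛ (q ⊛ q)
        := x ⊛ (con 1ℚ ⊕ y ⊛ q)) refl q x y) ⟩
  x * (1ℚ + y * q)                        ≤⟨ bernoulli-decay 0≤q q≤1 k ⟩
  1ℚ                                      ∎
  where
  open ℚ.≤-Reasoning
  x = (1ℚ - q) ^ k
  y = fromℕ k

module Base (x : ℕ) where
  X : ℕ
  X = suc x

  b β : ℚ
  b = fromℕ (suc X) * inv X
  β = fromℕ X * inv (suc X)

  b*β : b * β ≡ 1ℚ
  b*β = begin
    fromℕ (suc X) * inv X * (fromℕ X * inv (suc X))
      ≡⟨ solve 4 (λ p i q j → p ⊛ i ⊛ (q ⊛ j)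
          := (p ⊛ j) ⊛ (q ⊛ i)) refl (fromℕ (suc X)) (inv X) (fromℕ X) (inv (suc X)) ⟩
    fromℕ (suc X) * inv (suc X) * (fromℕ X * inv X) ≡⟨ cong₂ _*_ (fromℕ*inv X) (fromℕ*inv x) ⟩
    1ℚ * 1ℚ                                         ≡⟨⟩
    1ℚ                                              ∎
    where open ≡-Reasoning

  b≡1+inv : b ≡ 1ℚ + inv X
  b≡1+inv = begin
    fromℕ (suc X) * inv X      ≡⟨ cong (_* inv X) (fromℕ-suc X) ⟩
    (1ℚ + fromℕ X) * inv X     ≡⟨ solve 2 (λ f i → (con 1ℚ ⊕ f) ⊛ i := f ⊛ i ⊕ i) refl (fromℕ X) (inv X) ⟩
    fromℕ X * inv X + inv X    ≡⟨ cong (_+ inv X) (fromℕ*inv x) ⟩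
    1ℚ + inv X                 ∎
    where open ≡-Reasoning

  1≤b : 1ℚ ≤ b
  1≤b = ≤-by (0≤inv X) (sym b≡1+inv)

  0≤b : 0ℚ ≤ b
  0≤b = ℚ.≤-trans 0≤1 1≤b

  0≤β : 0ℚ ≤ β
  0≤β = 0≤* (0≤fromℕ X) (0≤inv (suc X))

  β≤1 : β ≤ 1ℚ
  β≤1 = subst₂ _≤_ (ℚ.*-identityˡ β) b*β (*-mono-≤ 0≤b 0≤β 1≤b ℚ.≤-refl)

  b^*β^ : ∀ k → b ^ k * β ^ k ≡ 1ℚ
  b^*β^ k = trans (sym (^-distrib-* b β k)) (trans (cong (_^ k) b*β) (1^ k))

  -- Telescoping: `(l + 1) / l ≤ (X + 1) / X` for every `l ≥ X`.
  b-growth : ∀ L k → X ℕ.≤ L → fromℕ (L ℕ.+ k) ≤ fromℕ L * b ^ k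
  b-growth L zero X≤L = ℚ.≤-reflexive (trans (cong fromℕ (ℕ.+-identityʳ L)) (sym (ℚ.*-identityʳ (fromℕ L))))
  b-growth L (suc k) X≤L = begin
    fromℕ (L ℕ.+ suc k)                       ≡⟨ trans (cong fromℕ (ℕ.+-suc L k)) (fromℕ-suc (L ℕ.+ k)) ⟩
    1ℚ + fromℕ (L ℕ.+ k)                      ≡⟨ cong (_+ fromℕ (L ℕ.+ k)) (fromℕ*inv x) ⟨
    fromℕ X * inv X + fromℕ (L ℕ.+ k)
      ≤⟨ ℚ.+-monoˡ-≤ (fromℕ (L ℕ.+ k)) (*-mono-≤ (0≤fromℕ (L ℕ.+ k)) (0≤inv X) (fromℕ-mono-≤ (ℕ.≤-trans X≤L (ℕ.m≤m+n L k))) ℚ.≤-refl) ⟩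
    fromℕ (L ℕ.+ k) * inv X + fromℕ (L ℕ.+ k)
      ≡⟨ solve 2 (λ f i → f ⊛ i ⊕ f := (con 1ℚ ⊕ i) ⊛ f) refl (fromℕ (L ℕ.+ k)) (inv X) ⟩
    (1ℚ + inv X) * fromℕ (L ℕ.+ k)            ≡⟨ cong (_* fromℕ (L ℕ.+ k)) b≡1+inv ⟨
    b * fromℕ (L ℕ.+ k)                       ≤⟨ *-monoˡ-≤ 0≤b (b-growth L k X≤L) ⟩
    b * (fromℕ L * b ^ k)
      ≡⟨ solve 3 (λ b l p → b ⊛ (l ⊛ p) := l ⊛ (b ⊛ p)) refl b (fromℕ L) (b ^ k) ⟩
    fromℕ L * (b * b ^ k)                     ∎
    where open ℚ.≤-Reasoning

  -- `b-growth` started at `L - r ≥ X`, multiplied by `β ^ r`.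
  β-decay : ∀ L r → X ℕ.+ r ℕ.≤ L → fromℕ r + fromℕ L * β ^ r ≤ fromℕ L
  β-decay L r X+r≤L = begin
    fromℕ r + fromℕ L * β ^ r               ≡⟨ cong (λ z → fromℕ r + fromℕ z * β ^ r) L≡ ⟨
    fromℕ r + fromℕ (L′ ℕ.+ r) * β ^ r
      ≤⟨ ℚ.+-monoʳ-≤ (fromℕ r) (*-mono-≤ (0≤* (0≤fromℕ L′) (0≤^ 0≤b r)) (0≤^ 0≤β r) (b-growth L′ r (ℕ.m+n≤o⇒m≤o∸n X X+r≤L)) ℚ.≤-refl) ⟩
    fromℕ r + fromℕ L′ * b ^ r * β ^ r
      ≡⟨ cong (λ z → fromℕ r + z) (trans (ℚ.*-assoc (fromℕ L′) (b ^ r) (β ^ r)) (trans (cong (fromℕ L′ *_) (b^*β^ r)) (ℚ.*-identityʳ _))) ⟩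
    fromℕ r + fromℕ L′                      ≡⟨ trans (ℚ.+-comm (fromℕ r) (fromℕ L′)) (sym (fromℕ-+ L′ r)) ⟩
    fromℕ (L′ ℕ.+ r)                        ≡⟨ cong fromℕ L≡ ⟩
    fromℕ L                                 ∎
    where
    open ℚ.≤-Reasoning
    L′ = L ℕ.∸ r
    L≡ : L′ ℕ.+ r ≡ L
    L≡ = ℕ.m∸n+n≡m (ℕ.≤-trans (ℕ.m≤n+m r X) X+r≤L)

  -- The opposite telescoping, below `X`, where `b ≤ (y + 1) / y`; so `b ^ t ≤ X / (X - t)`.
  b-cap : ∀ t y → t ℕ.+ y ≡ X → b ^ t * fromℕ y ≤ fromℕ X
  b-cap zero y refl = ℚ.≤-reflexive (ℚ.*-identityˡ _)
  b-cap (suc t) y t+y≡X = begin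
    b * b ^ t * fromℕ y                ≡⟨ solve 3 (λ b p y → b ⊛ p ⊛ y := p ⊛ (b ⊛ y)) refl b (b ^ t) (fromℕ y) ⟩
    b ^ t * (b * fromℕ y)              ≤⟨ *-monoˡ-≤ (0≤^ 0≤b t) step ⟩
    b ^ t * fromℕ (suc y)              ≤⟨ b-cap t (suc y) (trans (ℕ.+-suc t y) t+y≡X) ⟩
    fromℕ X                            ∎
    where
    open ℚ.≤-Reasoning
    step : b * fromℕ y ≤ fromℕ (suc y)
    step = begin
      b * fromℕ y
        ≡⟨ trans (cong (_* fromℕ y) b≡1+inv) (solve 2 (λ i y → (con 1ℚ ⊕ i) ⊛ y := y ⊛ i ⊕ y) refl (inv X) (fromℕ y)) ⟩
      fromℕ y * inv X + fromℕ y
        ≤⟨ ℚ.+-monoˡ-≤ (fromℕ y) (*-mono-≤ (0≤fromℕ X) (0≤inv X) (fromℕ-mono-≤ (ℕ.≤-trans (ℕ.m≤n+m y (suc t)) (ℕ.≤-reflexive t+y≡X))) ℚ.≤-refl) ⟩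
      fromℕ X * inv X + fromℕ y    ≡⟨ cong (_+ fromℕ y) (fromℕ*inv x) ⟩
      1ℚ + fromℕ y                 ≡⟨ fromℕ-suc y ⟨
      fromℕ (suc y)                ∎

  b^-≤3/2 : ∀ t → 3 ℕ.* suc t ≡ X → b ^ suc t ≤ (+ 3) ℚ./ 2
  b^-≤3/2 t 3t≡X = cancel-fromℕ 1 (cancel-fromℕ t (begin
    fromℕ (suc t) * (fromℕ 2 * b ^ suc t)
      ≡⟨ solve 3 (λ t w p → t ⊛ (w ⊛ p) := p ⊛ (t ⊛ w)) refl (fromℕ (suc t)) (fromℕ 2) (b ^ suc t) ⟩
    b ^ suc t * (fromℕ (suc t) * fromℕ 2)   ≡⟨ cong (b ^ suc t *_) (fromℕ-* (suc t) 2) ⟨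
    b ^ suc t * fromℕ (suc t ℕ.* 2)
      ≤⟨ b-cap (suc t) (suc t ℕ.* 2) (trans (N.solve 1 (λ t → t N.:+ t N.:* N.con 2
          N.:= N.con 3 N.:* t) refl (suc t)) 3t≡X) ⟩
    fromℕ X                                 ≡⟨ cong fromℕ (trans (sym 3t≡X) (ℕ.*-comm 3 (suc t))) ⟩
    fromℕ (suc t ℕ.* 3)                     ≡⟨ fromℕ-* (suc t) 3 ⟩
    fromℕ (suc t) * fromℕ 3                 ∎))
    where open ℚ.≤-Reasoning

archimedean : ∀ δ → 0ℚ < δ → ∃ λ D → fromℕ 2 ≤ fromℕ (suc D) * δ
archimedean δ@(mkℚ (ℤ.+[1+ a ]) d _) _ = suc (2 ℕ.* d) , ℚ.toℚᵘ-cancel-≤ (begin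
  toℚᵘ (fromℕ 2)                                   ≤⟨ ℚᵘ.*≤* (ℤ.+≤+ (num a d)) ⟩
  ℚᵘ.mkℚᵘ (+ suc (suc (2 ℕ.* d))) 0 ℚᵘ.* toℚᵘ δ
    ≃⟨ ℚᵘ.*-congʳ {toℚᵘ δ} (ℚ.toℚᵘ-fromℚᵘ (ℚᵘ.mkℚᵘ (+ suc (suc (2 ℕ.* d))) 0)) ⟨
  toℚᵘ (fromℕ (suc (suc (2 ℕ.* d)))) ℚᵘ.* toℚᵘ δ   ≃⟨ ℚ.toℚᵘ-homo-* (fromℕ (suc (suc (2 ℕ.* d)))) δ ⟨
  toℚᵘ (fromℕ (suc (suc (2 ℕ.* d))) * δ)           ∎)
  where
  open ℚᵘ.≤-Reasoning
  num : ∀ a d → 2 ℕ.* (1 ℕ.* suc d) ℕ.≤ suc (suc (2 ℕ.* d)) ℕ.* suc a ℕ.* 1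
  num a d = ℕ.≤-trans (ℕ.m≤m+n _ (suc (suc (2 ℕ.* d)) ℕ.* a))
    (ℕ.≤-reflexive (N.solve 2 (λ a d → N.con 2 N.:* (N.con 1 N.:* (N.con 1 N.:+ d)) N.:+ (N.con 2 N.:+ N.con 2 N.:* d) N.:* a
      N.:= (N.con 2 N.:+ N.con 2 N.:* d) N.:* (N.con 1 N.:+ a) N.:* N.con 1) refl a d))
archimedean (mkℚ (ℤ.+ 0) d _) (ℚ.*<* (ℤ.+<+ ()))
archimedean (mkℚ (ℤ.-[1+ a ]) d _) (ℚ.*<* ())

-- Lower bounds for partial sums of exp

expTerm : ℕ → ℚ → ℚ
expTerm k x = proj₂ (expTerms k x)

expPartial-suc : ∀ k x → expPartial (suc k) x ≡ expPartial k x + expTerm k x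
expPartial-suc k x with expTerms k x
... | s , t = refl

expTerm-suc : ∀ k x → expTerm (suc k) x ≡ expTerm k x * x * inv (suc k)
expTerm-suc k x with expTerms k x
... | s , t = refl

0≤expTerm : ∀ k {x} → 0ℚ ≤ x → 0ℚ ≤ expTerm k x
0≤expTerm zero 0≤x = 0≤1
0≤expTerm (suc k) {x} 0≤x = subst (0ℚ ≤_) (sym (expTerm-suc k x)) (0≤* (0≤* (0≤expTerm k 0≤x) 0≤x) (0≤inv (suc k)))

0≤expPartial : ∀ k {x} → 0ℚ ≤ x → 0ℚ ≤ expPartial k x
0≤expPartial zero 0≤x = ℚ.≤-refl
0≤expPartial (suc k) {x} 0≤x = subst (0ℚ ≤_) (sym (expPartial-suc k x)) (0≤+ (0≤expPartial k 0≤x) (0≤expTerm k 0≤x))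

-- First-order expansion of `x ^ (k + 1) / (k + 1)!`, whose derivative is the preceding term; the
-- induction drops a multiple of `h²`.
expTerm-step : ∀ k {x h} → 0ℚ ≤ x → 0ℚ ≤ h → expTerm (suc k) x + h * expTerm k x ≤ expTerm (suc k) (x + h)
expTerm-step zero {x} {h} 0≤x 0≤h = ℚ.≤-reflexive (begin
  expTerm 1 x + h * 1ℚ        ≡⟨ cong (_+ h * 1ℚ) (expTerm-suc 0 x) ⟩
  1ℚ * x * 1ℚ + h * 1ℚ
    ≡⟨ solve 2 (λ x h → con 1ℚ ⊛ x ⊛ con 1ℚ ⊕ h ⊛ con 1ℚ := con 1ℚ ⊛ (x ⊕ h) ⊛ con 1ℚ) refl x h ⟩
  1ℚ * (x + h) * 1ℚ           ≡⟨ expTerm-suc 0 (x + h) ⟨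
  expTerm 1 (x + h)           ∎)
  where open ≡-Reasoning
expTerm-step (suc k) {x} {h} 0≤x 0≤h = begin
  expTerm (suc (suc k)) x + h * t₁                 ≡⟨ cong₂ (λ a b → a + h * b) (expTerm-suc (suc k) x) (sym t₁≡) ⟩
  t₁ * x * i₂ + h * ((t₁ + t₀ * x) * i₂)
    ≤⟨ ≤-by (0≤* (0≤* (0≤* 0≤h 0≤h) (0≤expTerm k 0≤x)) (0≤inv (suc (suc k))))
    (solve 5 (λ t₁ t₀ x h i → t₁ ⊛ x ⊛ i ⊕ h ⊛ ((t₁ ⊕ t₀ ⊛ x) ⊛ i) ⊕ h ⊛ h ⊛ t₀ ⊛ i
        := (t₁ ⊕ h ⊛ t₀) ⊛ (x ⊕ h) ⊛ i) refl t₁ t₀ x h i₂) ⟩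
  (t₁ + h * t₀) * (x + h) * i₂
    ≤⟨ *-mono-≤ (0≤* (0≤expTerm (suc k) 0≤x+h) 0≤x+h) (0≤inv (suc (suc k)))
                                                        (*-mono-≤ (0≤expTerm (suc k) 0≤x+h) 0≤x+h (expTerm-step k 0≤x 0≤h) ℚ.≤-refl) ℚ.≤-refl ⟩
  expTerm (suc k) (x + h) * (x + h) * i₂           ≡⟨ expTerm-suc (suc k) (x + h) ⟨
  expTerm (suc (suc k)) (x + h)                    ∎
  where
  open ℚ.≤-Reasoning
  t₀ = expTerm k x
  t₁ = expTerm (suc k) x
  i₁ = inv (suc k)
  i₂ = inv (suc (suc k))
  f₁ = fromℕ (suc k)
  0≤x+h : 0ℚ ≤ x + h
  0≤x+h = 0≤+ 0≤x 0≤h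
  t₀x≡ : t₀ * x ≡ f₁ * t₁
  t₀x≡ = E.begin
    t₀ * x                 E.≡⟨ ℚ.*-identityʳ _ ⟨
    t₀ * x * 1ℚ            E.≡⟨ cong (t₀ * x *_) (fromℕ*inv k) ⟨
    t₀ * x * (f₁ * i₁)     E.≡⟨ solve 3 (λ a f i → a ⊛ (f ⊛ i) := f ⊛ (a ⊛ i)) refl (t₀ * x) f₁ i₁ ⟩
    f₁ * (t₀ * x * i₁)     E.≡⟨ cong (f₁ *_) (expTerm-suc k x) ⟨
    f₁ * t₁                E.∎
    where module E = ≡-Reasoning
  t₁≡ : (t₁ + t₀ * x) * i₂ ≡ t₁
  t₁≡ = E.begin
    (t₁ + t₀ * x) * i₂           E.≡⟨ cong (λ z → (t₁ + z) * i₂) t₀x≡ ⟩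
    (t₁ + f₁ * t₁) * i₂          E.≡⟨ solve 3 (λ t f i → (t ⊕ f ⊛ t) ⊛ i := t ⊛ ((con 1ℚ ⊕ f) ⊛ i)) refl t₁ f₁ i₂ ⟩
    t₁ * ((1ℚ + f₁) * i₂)        E.≡⟨ cong (λ z → t₁ * (z * i₂)) (fromℕ-suc (suc k)) ⟨
    t₁ * (fromℕ (suc (suc k)) * i₂) E.≡⟨ cong (t₁ *_) (fromℕ*inv (suc k)) ⟩
    t₁ * 1ℚ                      E.≡⟨ ℚ.*-identityʳ t₁ ⟩
    t₁                           E.∎
    where module E = ≡-Reasoning

expPartial-step : ∀ k {x h} → 0ℚ ≤ x → 0ℚ ≤ h → expPartial (suc k) x + h * expPartial k x ≤ expPartial (suc k) (x + h)
expPartial-step zero {x} {h} 0≤x 0≤h = ℚ.≤-reflexive (trans (cong ((0ℚ + 1ℚ) ℚ.+_) (ℚ.*-zeroʳ h)) refl)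
expPartial-step (suc k) {x} {h} 0≤x 0≤h = begin
  expPartial (suc (suc k)) x + h * expPartial (suc k) x
    ≡⟨ cong₂ (λ a b → a + h * b) (expPartial-suc (suc k) x) (expPartial-suc k x) ⟩
  s₁ + expTerm (suc k) x + h * (s₀ + expTerm k x)
    ≡⟨ solve 5 (λ s₁ t₁ h s₀ t₀ → s₁ ⊕ t₁ ⊕ h ⊛ (s₀ ⊕ t₀)
        := (s₁ ⊕ h ⊛ s₀) ⊕ (t₁ ⊕ h ⊛ t₀)) refl s₁ (expTerm (suc k) x) h s₀ (expTerm k x) ⟩
  (s₁ + h * s₀) + (expTerm (suc k) x + h * expTerm k x)
    ≤⟨ ℚ.+-mono-≤ (expPartial-step k 0≤x 0≤h) (expTerm-step k 0≤x 0≤h) ⟩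
  expPartial (suc k) (x + h) + expTerm (suc k) (x + h)
    ≡⟨ expPartial-suc (suc k) (x + h) ⟨
  expPartial (suc (suc k)) (x + h) ∎
  where
  open ℚ.≤-Reasoning
  s₁ = expPartial (suc k) x
  s₀ = expPartial k x

expPartial-mono : ∀ k {x y} → 0ℚ ≤ x → x ≤ y → expPartial k x ≤ expPartial k y
expPartial-mono zero _ _ = ℚ.≤-refl
expPartial-mono (suc k) {x} {y} 0≤x x≤y = begin
  expPartial (suc k) x                            ≤⟨ ≤-by (0≤* (0≤- x≤y) (0≤expPartial k 0≤x)) refl ⟩
  expPartial (suc k) x + (y - x) * expPartial k x ≤⟨ expPartial-step k 0≤x (0≤- x≤y) ⟩
  expPartial (suc k) (x + (y - x))
    ≡⟨ cong (expPartial (suc k)) (solve 2 (λ x y → x ⊕ (y ⊖ x) := y) refl x y) ⟩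
  expPartial (suc k) y                            ∎
  where open ℚ.≤-Reasoning

-- The partial-sum form of (1 + h)^k ≤ exp (k h).
compound≤expPartial : ∀ {h} → 0ℚ ≤ h → ∀ k → (1ℚ + h) ^ k ≤ expPartial (suc k) (fromℕ k * h)
compound≤expPartial {h} 0≤h zero = ℚ.≤-refl
compound≤expPartial {h} 0≤h (suc k) = begin
  (1ℚ + h) * (1ℚ + h) ^ k          ≤⟨ *-monoˡ-≤ (0≤+ 0≤1 0≤h) (compound≤expPartial 0≤h k) ⟩
  (1ℚ + h) * s                     ≡⟨ solve 2 (λ h s → (con 1ℚ ⊕ h) ⊛ s := s ⊕ h ⊛ s) refl h s ⟩
  s + h * s
    ≤⟨ ℚ.+-monoˡ-≤ (h * s) (≤-by {s} (0≤expTerm (suc k) 0≤kh) (sym (expPartial-suc (suc k) (fromℕ k * h)))) ⟩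
  expPartial (suc (suc k)) (fromℕ k * h) + h * s ≤⟨ expPartial-step (suc k) 0≤kh 0≤h ⟩
  expPartial (suc (suc k)) (fromℕ k * h + h)
    ≡⟨ cong (expPartial (suc (suc k))) (trans (solve 2 (λ f h → f ⊛ h ⊕ h
        := (con 1ℚ ⊕ f) ⊛ h) refl (fromℕ k) h) (cong (_* h) (sym (fromℕ-suc k)))) ⟩
  expPartial (suc (suc k)) (fromℕ (suc k) * h) ∎
  where
  open ℚ.≤-Reasoning
  s = expPartial (suc k) (fromℕ k * h)
  0≤kh : 0ℚ ≤ fromℕ k * h
  0≤kh = 0≤* (0≤fromℕ k) 0≤h

-- Turns a lower bound on a power of `a / b` into a comparison of natural numbers that can be
-- evaluated.
fromℕ≤^ : ∀ {a b c y} k → 0 ℕ.< b → fromℕ b * y ≡ fromℕ a → b ℕ.^ k ℕ.* c ℕ.≤ a ℕ.^ k → fromℕ c ≤ y ^ k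
fromℕ≤^ {a} {b@(suc _)} {c} {y} k _ by≡a h = cancel-pos (ℕ.m^n>0 b k) (begin
  fromℕ (b ℕ.^ k) * fromℕ c   ≡⟨ fromℕ-* (b ℕ.^ k) c ⟨
  fromℕ (b ℕ.^ k ℕ.* c)       ≤⟨ fromℕ-mono-≤ h ⟩
  fromℕ (a ℕ.^ k)             ≡⟨ fromℕ-^ a k ⟩
  fromℕ a ^ k                 ≡⟨ cong (_^ k) by≡a ⟨
  (fromℕ b * y) ^ k           ≡⟨ ^-distrib-* (fromℕ b) y k ⟩
  fromℕ b ^ k * y ^ k         ≡⟨ cong (_* y ^ k) (fromℕ-^ b k) ⟨
  fromℕ (b ℕ.^ k) * y ^ k     ∎)
  where
  open ℚ.≤-Reasoning
  cancel-pos : ∀ {u p r} → 0 ℕ.< u → fromℕ u * p ≤ fromℕ u * r → p ≤ r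
  cancel-pos {suc u} _ = cancel-fromℕ u

-- exp 2 > (1 + 1/20)^40 > 7
7^m≤exp2m : ∀ m → fromℕ (7 ℕ.^ m) ≤ expPartial (suc (40 ℕ.* m)) (fromℕ m * fromℕ 2)
7^m≤exp2m m = begin
  fromℕ (7 ℕ.^ m)               ≡⟨ fromℕ-^ 7 m ⟩
  fromℕ 7 ^ m                   ≤⟨ ^-monoˡ-≤ (0≤fromℕ 7) 7≤y^40 m ⟩
  (y ^ 40) ^ m                  ≡⟨ ^-assocʳ y 40 m ⟩
  y ^ (40 ℕ.* m)                ≤⟨ compound≤expPartial (0≤inv 20) (40 ℕ.* m) ⟩
  expPartial (suc (40 ℕ.* m)) (fromℕ (40 ℕ.* m) * inv 20) ≡⟨ cong (expPartial (suc (40 ℕ.* m))) arg ⟩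
  expPartial (suc (40 ℕ.* m)) (fromℕ m * fromℕ 2) ∎
  where
  open ℚ.≤-Reasoning
  y = 1ℚ + inv 20
  7≤y^40 : fromℕ 7 ≤ y ^ 40
  -- The margin is thin: `(21/20) ^ 40` is about 7.04.
  7≤y^40 = fromℕ≤^ {21} {20} {7} {y} 40 (s≤s z≤n) refl (ℕ.≤ᵇ⇒≤ (20 ℕ.^ 40 ℕ.* 7) (21 ℕ.^ 40) tt)
  arg : fromℕ (40 ℕ.* m) * inv 20 ≡ fromℕ m * fromℕ 2
  arg = trans (cong (_* inv 20) (fromℕ-* 40 m)) (solve 1 (λ m → con (fromℕ 40) ⊛ m ⊛ con (inv 20)
      := m ⊛ con (fromℕ 2)) refl (fromℕ m))

2^y≤exp : ∀ y → fromℕ (2 ℕ.^ y) ≤ expPartial (suc y) (fromℕ y)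
2^y≤exp y = subst₂ _≤_ (sym (fromℕ-^ 2 y)) (cong (expPartial (suc y)) (ℚ.*-identityʳ (fromℕ y))) (compound≤expPartial 0≤1 y)

recip-≥2 : ∀ c → 0ℚ < c → c ≤ ½ → fromℕ 2 ≤ recip c
recip-≥2 c 0<c c≤½ with c ℚ.≟ 0ℚ
... | yes refl = contradiction 0<c (ℚ.<-irrefl refl)
... | no c≢0 = ℚ.*-cancelˡ-≤-pos c {{ℚ.positive 0<c}} (begin
  c * fromℕ 2                              ≤⟨ ℚ.*-monoʳ-≤-nonNeg (fromℕ 2) c≤½ ⟩
  ½ * fromℕ 2                              ≡⟨⟩
  1ℚ                                       ≡⟨ ℚ.*-inverseʳ c {{ℚ.≢-nonZero c≢0}} ⟨
  c * (ℚ.1/ c) {{ℚ.≢-nonZero c≢0}}         ∎)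
  where open ℚ.≤-Reasoning

-- The hypothesis is used at the two indices where compounding bounds the inner exponential by
-- `7 ^ m` and the outer one by a power of 2.
2^7^m≤n : ∀ {c m n} → 0ℚ < c → c ≤ ½ → LeCLnLn c m n → 2 ℕ.^ (7 ℕ.^ m) ℕ.≤ n
2^7^m≤n {c} {m} {n} 0<c c≤½ h = fromℕ-cancel-≤ (begin
  fromℕ (2 ℕ.^ (7 ℕ.^ m))                        ≤⟨ 2^y≤exp (7 ℕ.^ m) ⟩
  expPartial j (fromℕ (7 ℕ.^ m))                 ≤⟨ expPartial-mono j (0≤fromℕ (7 ℕ.^ m)) (7^m≤exp2m m) ⟩
  expPartial j (expPartial k (fromℕ m * fromℕ 2))
    ≤⟨ expPartial-mono j (0≤expPartial k 0≤2m) (expPartial-mono k 0≤2m (*-monoˡ-≤ (0≤fromℕ m) (recip-≥2 c 0<c c≤½))) ⟩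
  expPartial j (expPartial k (fromℕ m * recip c)) ≤⟨ h j k ⟩
  fromℕ n                                        ∎)
  where
  open ℚ.≤-Reasoning
  j = suc (7 ℕ.^ m)
  k = suc (40 ℕ.* m)
  0≤2m : 0ℚ ≤ fromℕ m * fromℕ 2
  0≤2m = 0≤* (0≤fromℕ m) (0≤fromℕ 2)

-- Choice of the parameters

n<2^n : ∀ n → n ℕ.< 2 ℕ.^ n
n<2^n zero = s≤s z≤n
n<2^n (suc n) = begin
  suc (suc n)               ≡⟨ ℕ.+-comm 1 (suc n) ⟩
  suc n ℕ.+ 1               ≤⟨ ℕ.+-mono-≤ (n<2^n n) (ℕ.m^n>0 2 n) ⟩
  2 ℕ.^ n ℕ.+ 2 ℕ.^ n       ≡⟨ cong (2 ℕ.^ n ℕ.+_) (ℕ.+-identityʳ (2 ℕ.^ n)) ⟨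
  2 ℕ.^ suc n               ∎
  where open ℕ.≤-Reasoning

-- The polynomial `p` is chosen so that `7 p(m) - 6 p(m + 1) = m²`; thus `p(m) (6/7)^m` never
-- increases from its initial value 78.
quadratic*6^m≤78*7^m : ∀ m → (m ℕ.* m ℕ.+ 12 ℕ.* m ℕ.+ 78) ℕ.* 6 ℕ.^ m ℕ.≤ 78 ℕ.* 7 ℕ.^ m
quadratic*6^m≤78*7^m zero = ℕ.≤-refl
quadratic*6^m≤78*7^m (suc m) = begin
  (suc m ℕ.* suc m ℕ.+ 12 ℕ.* suc m ℕ.+ 78) ℕ.* (6 ℕ.* p)       ≤⟨ ℕ.m≤m+n _ (m ℕ.* m ℕ.* p) ⟩
  (suc m ℕ.* suc m ℕ.+ 12 ℕ.* suc m ℕ.+ 78) ℕ.* (6 ℕ.* p) ℕ.+ m ℕ.* m ℕ.* p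
    ≡⟨ N.solve 2 (λ m p → ((N.con 1 N.:+ m) N.:* (N.con 1 N.:+ m) N.:+ N.con 12 N.:* (N.con 1 N.:+ m) N.:+ N.con 78) N.:* (N.con 6 N.:* p) N.:+ m N.:* m N.:* p
         N.:= N.con 7 N.:* ((m N.:* m N.:+ N.con 12 N.:* m N.:+ N.con 78) N.:* p)) refl m p ⟩
  7 ℕ.* ((m ℕ.* m ℕ.+ 12 ℕ.* m ℕ.+ 78) ℕ.* p)                   ≤⟨ ℕ.*-monoʳ-≤ 7 (quadratic*6^m≤78*7^m m) ⟩
  7 ℕ.* (78 ℕ.* 7 ℕ.^ m)
    ≡⟨ N.solve 1 (λ z → N.con 7 N.:* (N.con 78 N.:* z) N.:= N.con 78 N.:* (N.con 7 N.:* z)) refl (7 ℕ.^ m) ⟩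
  78 ℕ.* (7 ℕ.* 7 ℕ.^ m)                                        ∎
  where
  open ℕ.≤-Reasoning
  p = 6 ℕ.^ m

linear*6^m≤7^m : ∀ C m → 78 ℕ.* C ℕ.≤ m → C ℕ.* (suc m ℕ.* 6 ℕ.^ m) ℕ.≤ 7 ℕ.^ m
linear*6^m≤7^m C m 78C≤m = ℕ.*-cancelˡ-≤ 78 (begin
  78 ℕ.* (C ℕ.* (suc m ℕ.* p))                ≡⟨ ℕ.*-assoc 78 C _ ⟨
  78 ℕ.* C ℕ.* (suc m ℕ.* p)                  ≤⟨ ℕ.*-monoˡ-≤ (suc m ℕ.* p) 78C≤m ⟩
  m ℕ.* (suc m ℕ.* p)                         ≤⟨ ℕ.m≤m+n _ ((11 ℕ.* m ℕ.+ 78) ℕ.* p) ⟩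
  m ℕ.* (suc m ℕ.* p) ℕ.+ (11 ℕ.* m ℕ.+ 78) ℕ.* p
    ≡⟨ N.solve 2 (λ m p → m N.:* ((N.con 1 N.:+ m) N.:* p) N.:+ (N.con 11 N.:* m N.:+ N.con 78) N.:* p
         N.:= (m N.:* m N.:+ N.con 12 N.:* m N.:+ N.con 78) N.:* p) refl m p ⟩
  (m ℕ.* m ℕ.+ 12 ℕ.* m ℕ.+ 78) ℕ.* p         ≤⟨ quadratic*6^m≤78*7^m m ⟩
  78 ℕ.* 7 ℕ.^ m                              ∎)
  where
  open ℕ.≤-Reasoning
  p = 6 ℕ.^ m

-- D is of order 1/δ, and J + 1 is the number of tries.
module Sizes (D₀ m n : ℕ) where
  D J K : ℕ
  D = suc D₀
  J = D ℕ.* 6 ℕ.^ m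
  K = D ℕ.* (suc m ℕ.* 6 ℕ.^ m)

  1≤J : 1 ℕ.≤ J
  1≤J = ℕ.*-mono-≤ (s≤s (z≤n {D₀})) (ℕ.m^n>0 6 m)

  K≡ : K ≡ J ℕ.* suc m
  K≡ = N.solve 3 (λ d m p → d N.:* (m N.:* p) N.:= d N.:* p N.:* m) refl D (suc m) (6 ℕ.^ m)

  J≤K : J ℕ.≤ K
  J≤K = ℕ.≤-trans (ℕ.m≤m*n J (suc m)) (ℕ.≤-reflexive (sym K≡))

  1≤K : 1 ℕ.≤ K
  1≤K = ℕ.≤-trans 1≤J J≤K

  D≤K : D ℕ.≤ K
  D≤K = ℕ.≤-trans (ℕ.m≤m*n D (6 ℕ.^ m) {{ℕ.>-nonZero (ℕ.m^n>0 6 m)}}) J≤K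

  tries : suc J ℕ.* suc m ℕ.≤ 2 ℕ.* K
  tries = begin
    suc J ℕ.* suc m          ≤⟨ ℕ.*-monoˡ-≤ (suc m) (ℕ.+-monoˡ-≤ J 1≤J) ⟩
    (J ℕ.+ J) ℕ.* suc m      ≡⟨ N.solve 2 (λ j m → (j N.:+ j) N.:* m N.:= N.con 2 N.:* (j N.:* m)) refl J (suc m) ⟩
    2 ℕ.* (J ℕ.* suc m)      ≡⟨ cong (2 ℕ.*_) K≡ ⟨
    2 ℕ.* K                  ∎
    where open ℕ.≤-Reasoning

  module _ (large : 2 ℕ.^ (100 ℕ.* K) ℕ.≤ n) where
    open ℕ.≤-Reasoning

    scarcity-size : 3 ℕ.* D ℕ.* 2 ℕ.^ (48 ℕ.* (suc J ℕ.* m)) ℕ.≤ n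
    scarcity-size = begin
      3 ℕ.* D ℕ.* 2 ℕ.^ (48 ℕ.* (suc J ℕ.* m))
        ≤⟨ ℕ.*-mono-≤ (ℕ.*-mono-≤ {3} {4} (s≤s (s≤s (s≤s z≤n))) (ℕ.≤-trans D≤K (ℕ.<⇒≤ (n<2^n K))))
                                                             (ℕ.^-monoʳ-≤ 2 (ℕ.*-monoʳ-≤ 48 (ℕ.≤-trans (ℕ.*-monoʳ-≤ (suc J) (ℕ.n≤1+n m)) tries))) ⟩
      2 ℕ.^ 2 ℕ.* 2 ℕ.^ K ℕ.* 2 ℕ.^ (48 ℕ.* (2 ℕ.* K))
        ≡⟨ cong (ℕ._* 2 ℕ.^ (48 ℕ.* (2 ℕ.* K))) (ℕ.^-distribˡ-+-* 2 2 K) ⟨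
      2 ℕ.^ (2 ℕ.+ K) ℕ.* 2 ℕ.^ (48 ℕ.* (2 ℕ.* K))      ≡⟨ ℕ.^-distribˡ-+-* 2 (2 ℕ.+ K) _ ⟨
      2 ℕ.^ (2 ℕ.+ K ℕ.+ 48 ℕ.* (2 ℕ.* K))
        ≤⟨ ℕ.^-monoʳ-≤ 2 (ℕ.+-monoˡ-≤ (48 ℕ.* (2 ℕ.* K)) (ℕ.+-monoˡ-≤ K (ℕ.*-monoʳ-≤ 2 1≤K))) ⟩
      2 ℕ.^ (2 ℕ.* K ℕ.+ K ℕ.+ 48 ℕ.* (2 ℕ.* K))
        ≡⟨ cong (2 ℕ.^_) (N.solve 1 (λ k → N.con 2 N.:* k N.:+ k N.:+ N.con 48 N.:* (N.con 2 N.:* k)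
            N.:= N.con 99 N.:* k) refl K) ⟩
      2 ℕ.^ (99 ℕ.* K)                                  ≤⟨ ℕ.^-monoʳ-≤ 2 (ℕ.*-monoˡ-≤ K (ℕ.≤ᵇ⇒≤ 99 100 tt)) ⟩
      2 ℕ.^ (100 ℕ.* K)                                 ≤⟨ large ⟩
      n                                                 ∎

    board-size : 39 ℕ.+ 8 ℕ.* (suc J ℕ.* suc m) ℕ.≤ n
    board-size = begin
      39 ℕ.+ 8 ℕ.* (suc J ℕ.* suc m)    ≤⟨ ℕ.+-mono-≤ (ℕ.*-monoʳ-≤ 39 1≤K) (ℕ.*-monoʳ-≤ 8 tries) ⟩
      39 ℕ.* K ℕ.+ 8 ℕ.* (2 ℕ.* K)
        ≡⟨ N.solve 1 (λ k → N.con 39 N.:* k N.:+ N.con 8 N.:* (N.con 2 N.:* k) N.:= N.con 55 N.:* k) refl K ⟩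
      55 ℕ.* K                          ≤⟨ ℕ.*-monoˡ-≤ K (ℕ.≤ᵇ⇒≤ 55 100 tt) ⟩
      100 ℕ.* K                         ≤⟨ ℕ.<⇒≤ (n<2^n (100 ℕ.* K)) ⟩
      2 ℕ.^ (100 ℕ.* K)                 ≤⟨ large ⟩
      n                                 ∎

-- The 39 collects `3 + 24` from three times the rounding bound on `8 t` and 12 from the terms
-- linear in `n`.
room-arith : ∀ n t T e → 8 ℕ.* t ℕ.≤ n ℕ.* suc n ℕ.+ 8 → n ℕ.* n ℕ.≤ e ℕ.+ (e ℕ.+ n) → 39 ℕ.+ 8 ℕ.* T ℕ.≤ n →
  3 ℕ.* t ℕ.+ n ℕ.+ T ℕ.* n ℕ.≤ e
room-arith n t T e t-small edges n-large = ℕ.*-cancelˡ-≤ 8 (ℕ.+-cancelʳ-≤ (4 ℕ.* n) _ _ (begin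
  8 ℕ.* (3 ℕ.* t ℕ.+ n ℕ.+ T ℕ.* n) ℕ.+ 4 ℕ.* n
    ≡⟨ N.solve 3 (λ t n T → N.con 8 N.:* (N.con 3 N.:* t N.:+ n N.:+ T N.:* n) N.:+ N.con 4 N.:* n
         N.:= N.con 3 N.:* (N.con 8 N.:* t) N.:+ (N.con 12 N.:* n N.:+ N.con 8 N.:* T N.:* n)) refl t n T ⟩
  3 ℕ.* (8 ℕ.* t) ℕ.+ rest                    ≤⟨ ℕ.+-monoˡ-≤ rest (ℕ.*-monoʳ-≤ 3 t-small) ⟩
  3 ℕ.* (n ℕ.* suc n ℕ.+ 8) ℕ.+ rest
    ≤⟨ ℕ.+-monoˡ-≤ rest (ℕ.*-monoʳ-≤ 3 (ℕ.+-monoʳ-≤ (n ℕ.* suc n) (ℕ.*-monoʳ-≤ 8 1≤n))) ⟩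
  3 ℕ.* (n ℕ.* suc n ℕ.+ 8 ℕ.* n) ℕ.+ rest
    ≡⟨ N.solve 2 (λ n T → N.con 3 N.:* (n N.:* (N.con 1 N.:+ n) N.:+ N.con 8 N.:* n) N.:+ (N.con 12 N.:* n N.:+ N.con 8 N.:* T N.:* n)
         N.:= N.con 3 N.:* (n N.:* n) N.:+ (N.con 39 N.:+ N.con 8 N.:* T) N.:* n) refl n T ⟩
  3 ℕ.* (n ℕ.* n) ℕ.+ (39 ℕ.+ 8 ℕ.* T) ℕ.* n  ≤⟨ ℕ.+-monoʳ-≤ (3 ℕ.* (n ℕ.* n)) (ℕ.*-monoˡ-≤ n n-large) ⟩
  3 ℕ.* (n ℕ.* n) ℕ.+ n ℕ.* n
    ≡⟨ N.solve 1 (λ s → N.con 3 N.:* s N.:+ s N.:= N.con 4 N.:* s) refl (n ℕ.* n) ⟩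
  4 ℕ.* (n ℕ.* n)                             ≤⟨ ℕ.*-monoʳ-≤ 4 edges ⟩
  4 ℕ.* (e ℕ.+ (e ℕ.+ n))
    ≡⟨ N.solve 2 (λ e n → N.con 4 N.:* (e N.:+ (e N.:+ n)) N.:= N.con 8 N.:* e N.:+ N.con 4 N.:* n) refl e n ⟩
  8 ℕ.* e ℕ.+ 4 ℕ.* n                         ∎))
  where
  open ℕ.≤-Reasoning
  rest = 12 ℕ.* n ℕ.+ 8 ℕ.* T ℕ.* n
  1≤n : 1 ℕ.≤ n
  1≤n = ℕ.≤-trans (s≤s z≤n) n-large

-- t is about n²/8, so that 3t (a little below the number of edges of K_n) is a lower bound on the number of unclaimed
-- edges until all tries are over.
module Instance (D₀ m n : ℕ) (e₀ : Edge n) (0<n : 0 ℕ.< n) (large : 2 ℕ.^ (100 ℕ.* Sizes.K D₀ m n) ℕ.≤ n)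
  (t₀ : ℕ) (t-small : 8 ℕ.* suc t₀ ℕ.≤ n ℕ.* suc n ℕ.+ 8) (t-large : n ℕ.* suc n ℕ.≤ 8 ℕ.* suc t₀) where

  open Sizes D₀ m n
  open Board n

  t : ℕ
  t = suc t₀

  -- Written so that `X` unfolds to `3 * t`.
  open Base (t₀ ℕ.+ (t ℕ.+ (t ℕ.+ 0)))

  b^t≤3/2 : b ^ t ≤ (+ 3) ℚ./ 2
  b^t≤3/2 = b^-≤3/2 t₀ refl

  γ-growth : ∀ L → X ℕ.+ n ℕ.≤ L → fromℕ L + fromℕ 6 * fromℕ n ≤ fromℕ L * b ^ (6 ℕ.* n)
  γ-growth L h = subst (_≤ fromℕ L * b ^ (6 ℕ.* n)) (trans (fromℕ-+ L (6 ℕ.* n)) (cong (λ z → fromℕ L + z) (fromℕ-* 6 n)))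
    (b-growth L (6 ℕ.* n) (ℕ.≤-trans (ℕ.m≤m+n X n) h))

  open Analysis n m e₀ (X ℕ.+ n) (ℕ.≤-trans 0<n (ℕ.m≤n+m n X)) (b ^ (6 ℕ.* n)) β (1≤^ 1≤b (6 ℕ.* n)) 0≤β β≤1
    γ-growth (λ L r h r≤n → β-decay L r (ℕ.≤-trans (ℕ.+-monoʳ-≤ X r≤n) h))
    using (strategy; Invariant; breakerBound; loss; hazard; tri; steps; q; w; 0≤w)

  tri-closed : ∀ r → 2 ℕ.* tri r ℕ.+ m ℕ.* r ≡ m ℕ.* (r ℕ.* r)
  tri-closed zero = sym (trans (ℕ.*-zeroʳ m) (sym (ℕ.*-zeroʳ m)))
  tri-closed (suc r) = begin
    2 ℕ.* (m ℕ.* r ℕ.+ tri r) ℕ.+ m ℕ.* suc r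
      ≡⟨ N.solve 3 (λ m r t → N.con 2 N.:* (m N.:* r N.:+ t) N.:+ m N.:* (N.con 1 N.:+ r)
          N.:= (N.con 2 N.:* t N.:+ m N.:* r) N.:+ (N.con 2 N.:* (m N.:* r) N.:+ m)) refl m r (tri r) ⟩
    (2 ℕ.* tri r ℕ.+ m ℕ.* r) ℕ.+ (2 ℕ.* (m ℕ.* r) ℕ.+ m)  ≡⟨ cong (ℕ._+ (2 ℕ.* (m ℕ.* r) ℕ.+ m)) (tri-closed r) ⟩
    m ℕ.* (r ℕ.* r) ℕ.+ (2 ℕ.* (m ℕ.* r) ℕ.+ m)
      ≡⟨ N.solve 2 (λ m r → m N.:* (r N.:* r) N.:+ (N.con 2 N.:* (m N.:* r) N.:+ m)
          N.:= m N.:* ((N.con 1 N.:+ r) N.:* (N.con 1 N.:+ r))) refl m r ⟩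
    m ℕ.* (suc r ℕ.* suc r)                                ∎
    where open ≡-Reasoning

  hazard-small : hazard n m ℕ.≤ t ℕ.* (4 ℕ.* m)
  hazard-small = ℕ.*-cancelˡ-≤ 2 (begin
    2 ℕ.* (m ℕ.* n ℕ.+ tri n)
      ≡⟨ N.solve 2 (λ a t → N.con 2 N.:* (a N.:+ t) N.:= (N.con 2 N.:* t N.:+ a) N.:+ a) refl (m ℕ.* n) (tri n) ⟩
    (2 ℕ.* tri n ℕ.+ m ℕ.* n) ℕ.+ m ℕ.* n       ≡⟨ cong (ℕ._+ m ℕ.* n) (tri-closed n) ⟩
    m ℕ.* (n ℕ.* n) ℕ.+ m ℕ.* n
      ≡⟨ N.solve 2 (λ m n → m N.:* (n N.:* n) N.:+ m N.:* n N.:= m N.:* (n N.:* (N.con 1 N.:+ n))) refl m n ⟩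
    m ℕ.* (n ℕ.* suc n)                         ≤⟨ ℕ.*-monoʳ-≤ m t-large ⟩
    m ℕ.* (8 ℕ.* t)
      ≡⟨ N.solve 2 (λ m t → m N.:* (N.con 8 N.:* t) N.:= N.con 2 N.:* (t N.:* (N.con 4 N.:* m))) refl m t ⟩
    2 ℕ.* (t ℕ.* (4 ℕ.* m))                     ∎)
    where open ℕ.≤-Reasoning

  -- `1 / q = b ^ hazard n m ≤ (b ^ t) ^ (4 m) ≤ (81/16) ^ m`, which is where the base 6 comes from.
  1≤q*6^m : 1ℚ ≤ q * fromℕ (6 ℕ.^ m)
  1≤q*6^m = begin
    1ℚ                                          ≡⟨ trans (ℚ.*-comm q (b ^ hazard n m)) (b^*β^ (hazard n m)) ⟨
    q * b ^ hazard n m                          ≤⟨ *-monoˡ-≤ (0≤^ 0≤β (hazard n m)) (begin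
      b ^ hazard n m              ≤⟨ ^-monoʳ-≤ 1≤b hazard-small ⟩
      b ^ (t ℕ.* (4 ℕ.* m))       ≡⟨ ^-assocʳ b t (4 ℕ.* m) ⟨
      (b ^ t) ^ (4 ℕ.* m)         ≤⟨ ^-monoˡ-≤ (0≤^ 0≤b t) b^t≤3/2 (4 ℕ.* m) ⟩
      ((+ 3) ℚ./ 2) ^ (4 ℕ.* m)   ≡⟨ ^-assocʳ ((+ 3) ℚ./ 2) 4 m ⟨
      (((+ 3) ℚ./ 2) ^ 4) ^ m
        ≤⟨ ^-monoˡ-≤ (0≤^ {(+ 3) ℚ./ 2} (ℚ.nonNegative⁻¹ _) 4) (ℚ.*≤* (ℤ.+≤+ (ℕ.≤ᵇ⇒≤ 81 96 tt))) m ⟩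
      fromℕ 6 ^ m                 ≡⟨ fromℕ-^ 6 m ⟨
      fromℕ (6 ℕ.^ m)             ∎) ⟩
    q * fromℕ (6 ℕ.^ m)                         ∎
    where open ℚ.≤-Reasoning

  D*w^J≤1 : fromℕ D * w ^ J ≤ 1ℚ
  D*w^J≤1 = begin
    fromℕ D * w ^ J                   ≡⟨ solve 2 (λ d w → d ⊛ w := w ⊛ (d ⊛ con 1ℚ)) refl (fromℕ D) (w ^ J) ⟩
    w ^ J * (fromℕ D * 1ℚ)            ≤⟨ *-monoˡ-≤ (0≤^ 0≤w J) (*-monoˡ-≤ (0≤fromℕ D) 1≤q*6^m) ⟩
    w ^ J * (fromℕ D * (q * fromℕ (6 ℕ.^ m)))
      ≡⟨ cong (w ^ J *_) (trans (solve 3 (λ d q s → d ⊛ (q ⊛ s)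
          := d ⊛ s ⊛ q) refl (fromℕ D) q (fromℕ (6 ℕ.^ m))) (cong (_* q) (sym (fromℕ-* D (6 ℕ.^ m))))) ⟩
    w ^ J * (fromℕ J * q)             ≤⟨ *-monoˡ-≤ (0≤^ 0≤w J) (≤-by 0≤1 (ℚ.+-comm (fromℕ J * q) 1ℚ)) ⟩
    w ^ J * (1ℚ + fromℕ J * q)        ≤⟨ bernoulli-decay (0≤^ 0≤β (hazard n m)) (^≤1 0≤β β≤1 (hazard n m)) J ⟩
    1ℚ                                ∎
    where open ℚ.≤-Reasoning

  -- `(J + 1) m n` Maker edges at `b ^ (6 n)` each give exponent `6 (J + 1) m n² ≤ 48 (J + 1) m t`,
  -- and `b ^ t ≤ 2`.
  scarcity-small : fromℕ D * (fromℕ 3 * inv n * (b ^ (6 ℕ.* n)) ^ steps J n 0) ≤ 1ℚ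
  scarcity-small = begin
    fromℕ D * (fromℕ 3 * inv n * (b ^ (6 ℕ.* n)) ^ steps J n 0)
      ≡⟨ solve 4 (λ d h i p → d ⊛ (h ⊛ i ⊛ p)
          := h ⊛ d ⊛ p ⊛ i) refl (fromℕ D) (fromℕ 3) (inv n) ((b ^ (6 ℕ.* n)) ^ steps J n 0) ⟩
    fromℕ 3 * fromℕ D * (b ^ (6 ℕ.* n)) ^ steps J n 0 * inv n
      ≤⟨ *-mono-≤ (0≤* 0≤3D (0≤fromℕ (2 ℕ.^ e))) (0≤inv n) (*-monoˡ-≤ 0≤3D power) ℚ.≤-refl ⟩
    fromℕ 3 * fromℕ D * fromℕ (2 ℕ.^ e) * inv n
      ≡⟨ cong (_* inv n) (trans (cong (_* fromℕ (2 ℕ.^ e)) (sym (fromℕ-* 3 D))) (sym (fromℕ-* (3 ℕ.* D) (2 ℕ.^ e)))) ⟩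
    fromℕ (3 ℕ.* D ℕ.* 2 ℕ.^ e) * inv n
      ≤⟨ *-mono-≤ (0≤fromℕ n) (0≤inv n) (fromℕ-mono-≤ (scarcity-size large)) ℚ.≤-refl ⟩
    fromℕ n * inv n
      ≡⟨ fromℕ*inv⁺ 0<n ⟩
    1ℚ ∎
    where
    open ℚ.≤-Reasoning
    e = 48 ℕ.* (suc J ℕ.* m)
    0≤3D : 0ℚ ≤ fromℕ 3 * fromℕ D
    0≤3D = 0≤* (0≤fromℕ 3) (0≤fromℕ D)
    exponent : 6 ℕ.* n ℕ.* steps J n 0 ℕ.≤ t ℕ.* e
    exponent = R.begin
      6 ℕ.* n ℕ.* (J ℕ.* (m ℕ.* n) ℕ.+ m ℕ.* n)
        R.≡⟨ N.solve 3 (λ n j m → N.con 6 N.:* n N.:* (j N.:* (m N.:* n) N.:+ m N.:* n)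
            N.:= N.con 6 N.:* ((N.con 1 N.:+ j) N.:* m) N.:* (n N.:* n)) refl n J m ⟩
      6 ℕ.* (suc J ℕ.* m) ℕ.* (n ℕ.* n)
        R.≤⟨ ℕ.*-monoʳ-≤ (6 ℕ.* (suc J ℕ.* m)) (ℕ.≤-trans (ℕ.*-monoʳ-≤ n (ℕ.n≤1+n n)) t-large) ⟩
      6 ℕ.* (suc J ℕ.* m) ℕ.* (8 ℕ.* t)
        R.≡⟨ N.solve 2 (λ a t → N.con 6 N.:* a N.:* (N.con 8 N.:* t)
            N.:= t N.:* (N.con 48 N.:* a)) refl (suc J ℕ.* m) t ⟩
      t ℕ.* e                                    R.∎
      where module R = ℕ.≤-Reasoning
    power : (b ^ (6 ℕ.* n)) ^ steps J n 0 ≤ fromℕ (2 ℕ.^ e)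
    power = begin
      (b ^ (6 ℕ.* n)) ^ steps J n 0   ≡⟨ ^-assocʳ b (6 ℕ.* n) (steps J n 0) ⟩
      b ^ (6 ℕ.* n ℕ.* steps J n 0)   ≤⟨ ^-monoʳ-≤ 1≤b exponent ⟩
      b ^ (t ℕ.* e)                   ≡⟨ ^-assocʳ b t e ⟨
      (b ^ t) ^ e                     ≤⟨ ^-monoˡ-≤ (0≤^ 0≤b t) (ℚ.≤-trans b^t≤3/2 (ℚ.*≤* (ℤ.+≤+ (ℕ.≤ᵇ⇒≤ 3 4 tt)))) e ⟩
      fromℕ 2 ^ e                     ≡⟨ fromℕ-^ 2 e ⟨
      fromℕ (2 ℕ.^ e)                 ∎

  D*loss≤2 : fromℕ D * loss J n 0 n ≤ fromℕ 2
  D*loss≤2 = begin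
    fromℕ D * loss J n 0 n                                    ≡⟨ ℚ.*-distribˡ-+ (fromℕ D) _ _ ⟩
    fromℕ D * (fromℕ 3 * inv n * (b ^ (6 ℕ.* n)) ^ steps J n 0) + fromℕ D * (w ^ J * (1ℚ - β ^ hazard n 0))
      ≤⟨ ℚ.+-mono-≤ scarcity-small (ℚ.≤-trans (*-monoˡ-≤ (0≤fromℕ D) (begin
           w ^ J * (1ℚ - β ^ hazard n 0)
             ≤⟨ *-monoˡ-≤ (0≤^ 0≤w J) (≤-by (0≤^ 0≤β (hazard n 0)) (solve 1 (λ p → con 1ℚ ⊖ p ⊕ p
                 := con 1ℚ) refl (β ^ hazard n 0))) ⟩
           w ^ J * 1ℚ                      ≡⟨ ℚ.*-identityʳ _ ⟩
           w ^ J                           ∎)) D*w^J≤1) ⟩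
    1ℚ + 1ℚ                                                   ≡⟨⟩
    fromℕ 2                                                   ∎
    where open ℚ.≤-Reasoning

  room₀ : X ℕ.+ n ℕ.+ (steps J n 0 ℕ.+ (J ℕ.* n ℕ.+ n)) ℕ.≤ length (allEdges n)
  room₀ = ℕ.≤-trans (ℕ.≤-reflexive (cong ((X ℕ.+ n) ℕ.+_)
      (N.solve 3 (λ j m n → (j N.:* (m N.:* n) N.:+ m N.:* n) N.:+ (j N.:* n N.:+ n)
          N.:= (N.con 1 N.:+ j) N.:* (N.con 1 N.:+ m) N.:* n) refl J m n)))
    (room-arith n t (suc J ℕ.* suc m) (length (allEdges n)) t-small n²≤2∣E∣+n (board-size large))

  initial : Invariant J n 0 [] []
  initial = record
    { room  = ℕ.≤-trans room₀ (Unique-⊆⇒length≤ allEdges-unique (λ p → ∈-unclaimed⁺ {[]} {[]} p (λ ()) (λ ())))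
    ; quota = λ {v} _ → freeAt≤n v [] []
    ; r≤n   = ℕ.≤-refl
    ; k≤m   = z≤n
    }

  win : ∀ {δ} → fromℕ 2 ≤ fromℕ D * δ → Σ (Strategy n) (λ σ → 1ℚ - δ ≤ winProb n m σ)
  win {δ} 2≤Dδ = strategy , (begin
    1ℚ - δ
      ≤⟨ ℚ.+-monoʳ-≤ 1ℚ (ℚ.neg-antimono-≤ (cancel-fromℕ D₀ (ℚ.≤-trans D*loss≤2 2≤Dδ))) ⟩
    1ℚ - loss J n 0 n                        ≡⟨ cong (λ u → 1ℚ - loss J n 0 u) length-untouched-[] ⟨
    1ℚ - loss J n 0 (length (untouched []))  ≤⟨ breakerBound (suc (length (allEdges n))) [] [] J n initial
                                                  (ℕ.m≤n⇒m≤1+n (ℕ.≤-trans (ℕ.m≤n+m (J ℕ.* n ℕ.+ n) (steps J n 0)) (ℕ.≤-trans (ℕ.m≤n+m _ (X ℕ.+ n)) room₀))) ⟩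
    winProb n m strategy                     ∎)
    where open ℚ.≤-Reasoning

-- `t` is squeezed from both sides: the upper bound leaves room on the board, the lower one lets
-- powers of `b ^ t` absorb exponents of order `n²`.
near-eighth : ∀ k → ∃ λ t₀ → 8 ℕ.* suc t₀ ℕ.≤ k ℕ.+ 8 × k ℕ.≤ 8 ℕ.* suc t₀
near-eighth k = k ℕ./ 8 , small , large
  where
  open ℕ.≤-Reasoning
  small : 8 ℕ.* suc (k ℕ./ 8) ℕ.≤ k ℕ.+ 8
  small = begin
    8 ℕ.* suc (k ℕ./ 8)
      ≡⟨ N.solve 1 (λ t → N.con 8 N.:* (N.con 1 N.:+ t) N.:= t N.:* N.con 8 N.:+ N.con 8) refl (k ℕ./ 8) ⟩
    k ℕ./ 8 ℕ.* 8 ℕ.+ 8    ≤⟨ ℕ.+-monoˡ-≤ 8 (m/n*n≤m k 8) ⟩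
    k ℕ.+ 8                ∎
  large : k ℕ.≤ 8 ℕ.* suc (k ℕ./ 8)
  large = begin
    k                            ≡⟨ m≡m%n+[m/n]*n k 8 ⟩
    k ℕ.% 8 ℕ.+ k ℕ./ 8 ℕ.* 8    ≤⟨ ℕ.+-monoˡ-≤ (k ℕ./ 8 ℕ.* 8) (ℕ.<⇒≤ (m%n<n k 8)) ⟩
    suc (k ℕ./ 8) ℕ.* 8          ≡⟨ ℕ.*-comm (suc (k ℕ./ 8)) 8 ⟩
    8 ℕ.* suc (k ℕ./ 8)          ∎

exponent : ℕ → ℕ → ℕ
exponent D₀ m = 100 ℕ.* (suc D₀ ℕ.* (suc m ℕ.* 6 ℕ.^ m))

-- The hypothesis on `m` alone suffices only once `7 ^ m` beats `100 D (m + 1) 6 ^ m`; below `m₀`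
-- the size of `n` is supplied by the threshold.
exponent-large : ∀ D₀ m₀ m n → 78 ℕ.* (100 ℕ.* suc D₀) ℕ.≤ m₀ → 2 ℕ.^ exponent D₀ m₀ ℕ.≤ n → 2 ℕ.^ (7 ℕ.^ m) ℕ.≤ n →
  2 ℕ.^ exponent D₀ m ℕ.≤ n
exponent-large D₀ m₀ m n m₀-large n≥N h with ℕ.≤-total m m₀
... | inj₁ m≤m₀ = ℕ.≤-trans (ℕ.^-monoʳ-≤ 2 (ℕ.*-monoʳ-≤ 100 (ℕ.*-monoʳ-≤ (suc D₀) (ℕ.*-mono-≤ (s≤s m≤m₀) (ℕ.^-monoʳ-≤ 6 m≤m₀))))) n≥N
... | inj₂ m₀≤m = ℕ.≤-trans (ℕ.^-monoʳ-≤ 2 (ℕ.≤-trans (ℕ.≤-reflexive (sym (ℕ.*-assoc 100 (suc D₀) _)))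
                    (linear*6^m≤7^m (100 ℕ.* suc D₀) m (ℕ.≤-trans m₀-large m₀≤m)))) h

winning-strategy : ∀ D₀ m n {δ} → fromℕ 2 ≤ fromℕ (suc D₀) * δ → 2 ℕ.^ exponent D₀ m ℕ.≤ n →
  Σ (Strategy n) (λ σ → 1ℚ - δ ≤ winProb n m σ)
winning-strategy D₀ m zero 2≤Dδ large = contradiction (ℕ.≤-trans (ℕ.m^n>0 2 (exponent D₀ m)) large) λ ()
winning-strategy D₀ m n@(suc _) 2≤Dδ large with near-eighth (n ℕ.* suc n)
... | t₀ , t-small , t-large = Instance.win D₀ m n (Fin.zero , Fin.zero) (s≤s z≤n) large t₀ t-small t-large 2≤Dδ

-- m₀ is a variable here because 6 ^ m₀ would unfold thousands of times at m₀ = 78 * (100 * suc D₀).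
threshold : ∀ {c} → 0ℚ < c → c ≤ ½ → ∀ {δ} D₀ → fromℕ 2 ≤ fromℕ (suc D₀) * δ → ∀ m₀ → 78 ℕ.* (100 ℕ.* suc D₀) ℕ.≤ m₀ →
  ∃[ N ] ((n : ℕ) → n ≥ N → (m : ℕ) → LeCLnLn c m n → Σ (Strategy n) (λ σ → 1ℚ - δ ≤ winProb n m σ))
threshold 0<c c≤½ D₀ 2≤Dδ m₀ m₀-large = 2 ℕ.^ exponent D₀ m₀ , λ n n≥N m h →
  winning-strategy D₀ m n 2≤Dδ (exponent-large D₀ m₀ m n m₀-large n≥N (2^7^m≤n {m = m} 0<c c≤½ h))

theorem1p4 : (ε : ℚ) → 0ℚ < ε → ε < ½ →
    (δ : ℚ) → 0ℚ < δ →
    ∃[ N ] ((n : ℕ) → n ≥ N → (m : ℕ) → LeCLnLn (½ - ε) m n →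
    Σ (Strategy n) (λ σ → 1ℚ - δ ≤ winProb n m σ))
theorem1p4 ε 0<ε ε<½ δ 0<δ with archimedean δ 0<δ
... | D₀ , 2≤Dδ = threshold 0<c c≤½ D₀ 2≤Dδ (78 ℕ.* (100 ℕ.* suc D₀)) ℕ.≤-refl
  where
  0<c : 0ℚ < ½ - ε
  0<c = subst (_< ½ - ε) (ℚ.+-inverseʳ ε) (ℚ.+-monoˡ-< (- ε) ε<½)

  c≤½ : ½ - ε ≤ ½
  c≤½ = ≤-by (ℚ.<⇒≤ 0<ε) (solve 1 (λ e → con ½ ⊖ e ⊕ e := con ½) refl ε)
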